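{- Let $\nu(n)$ denote the median of the sizes of the primitive subsets of $\{1,2,\ldots,n\}$. Then for sufficiently large $n$, \[0.168153n <\nu(n) < 0.391752n.\]
   Context: A set of positive integers is primitive if no element divides another element. The median is taken over the multiset of cardinalities $|S|$ as $S$ ranges over all primitive subsets of $\{1,\ldots,n\}$. -}

module Defs where

open import Data.Nat using (ℕ; zero; suc; _+_; _*_; _∸_; _/_; _≤_)
open import Data.Nat.Properties using (≤-decTotalOrder)
open import Data.Nat.Divisibility using (_∣_; _∣?_)
open import Data.List using (List; []; _∷_; map; length; filter; applyUpTo)
open import Data.List.Relation.Unary.AllPairs using (AllPairs; allPairs?)
open import Data.List.Sort.MergeSort ≤-decTotalOrder using (sort)
open import Data.Product using (_×_)
open import Relation.Nullary using (¬_)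
open import Relation.Nullary.Decidable using (¬?; _×-dec_)
open import Relation.Unary using (Decidable)

subsets : List ℕ → List (List ℕ)
subsets []       = [] ∷ []
subsets (x ∷ xs) = subsets xs Data.List.++ map (x ∷_) (subsets xs)

oneTo : ℕ → List ℕ
oneTo n = applyUpTo suc n

Primitive : List ℕ → Set
Primitive = AllPairs (λ x y → ¬ (x ∣ y) × ¬ (y ∣ x))

primitive? : Decidable Primitive
primitive? = allPairs? (λ x y → ¬? (x ∣? y) ×-dec ¬? (y ∣? x))

primitiveSubsets : ℕ → List (List ℕ)
primitiveSubsets n = filter primitive? (subsets (oneTo n))

sortedSizes : ℕ → List ℕ
sortedSizes n = sort (map length (primitiveSubsets n))

nth : List ℕ → ℕ → ℕ
nth []       _       = 0
nth (x ∷ xs) zero    = x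
nth (x ∷ xs) (suc i) = nth xs i

-- twice the median of a sorted list a_0 ≤ ... ≤ a_{N-1}:
-- a_{⌊(N-1)/2⌋} + a_{⌊N/2⌋}  (usual median: middle element, or mean of
-- the two middle elements when N is even)
twiceMedian : List ℕ → ℕ
twiceMedian xs = nth xs ((length xs ∸ 1) / 2) + nth xs (length xs / 2)

twiceν : ℕ → ℕ
twiceν n = twiceMedian (sortedSizes n)

{-# OPTIONS --safe #-}
module Submission where

-- Weight every S ⊆ {1,…,n} by p^|S| q^(n−|S|).  The total weight of the primitive S is
-- submultiplicative under splitting the ground set, invariant under scaling it, and
-- multiplicative when no divisibility crosses the splitting.
--
-- Upper bound: all but the n/2⁹ smallest elements are covered by scaled copies of sets
-- {1,2,…,2^a} ∪ 3{1,2,…,2^c}, one for each v in (n/2, n]; the shape of the copy only depends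
-- on v mod 9·2¹⁰ and on whether v ≤ 2n/3, so the weight of a period is a finite computation.
-- Lower bound: the graph of divisibilities within (n/4, n] has small components, which give
-- at least 34560^⌊n/24⌋ primitive sets, 34560 = (5·8)·3·(3·3)·2³·4.
--
-- With (p, q) = (3, 1), respectively (1, 3), a Markov inequality then shows that sets of size
-- at least 0.391752 n, respectively at most 0.168153 n, form less than a quarter of all
-- primitive sets.

open import Defs
open import Data.Nat using (ℕ; _*_; _<_; _≥_)
open import Data.Product using (Σ; _×_)

open import Data.Bool as Bool using (if_then_else_; true; false)
open import Data.List using (List; []; _∷_; _++_; map; length; filter; concat; applyUpTo; _ʳ++_)
open import Data.List.Membership.Propositional using (_∈_)
open import Data.List.Membership.Propositional.Properties
open import Data.List.Properties using
  (map-++; map-∘; map-id; map-cong-local; map-applyUpTo; ++-identityʳ; length-++; length-map;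
   length-applyUpTo; filter-all)
open import Data.List.Relation.Binary.Permutation.Propositional renaming (trans to _∙_)
open import Data.List.Relation.Binary.Permutation.Propositional.Properties using
  (shift; ↭-reverse; ↭-length; ∈-resp-↭; filter-↭)
import Data.List.Relation.Binary.Permutation.Setoid.Properties as Permutation
open import Data.List.Relation.Binary.Subset.Propositional using (_⊆_)
open import Data.List.Relation.Binary.Subset.Propositional.Properties using (∷⁺ʳ)
open import Data.List.Relation.Unary.All as All using (All; []; _∷_)
import Data.List.Relation.Unary.All.Properties as All
open import Data.List.Relation.Unary.AllPairs as AllPairs using (AllPairs; []; _∷_)
import Data.List.Relation.Unary.AllPairs.Properties as AllPairs
open import Data.List.Relation.Unary.Any using (here; there)
open import Data.List.Relation.Unary.Sorted.TotalOrder.Properties using (Sorted⇒AllPairs)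
open import Data.List.Relation.Unary.Unique.Propositional using (Unique)
import Data.List.Relation.Unary.Unique.Propositional.Properties as Unique
open import Data.Nat hiding (_*_; _<_; _≥_)
open import Data.Nat.Divisibility
open import Data.Nat.DivMod using (m/n*n≤m; m*n/n≡m; m≡m%n+[m/n]*n; m%n<n; /-monoˡ-≤)
open import Data.Nat.ListAction using (sum; product)
open import Data.Nat.ListAction.Properties using (sum-++; product-++)
open import Data.Nat.Primality using (euclidsLemma; prime[2]; prime?)
open import Data.Nat.Properties
open import Data.Nat.Solver using (module +-*-Solver)
open import Data.List.Relation.Unary.Unique.DecPropositional _≟_ using (unique?)
open import Data.List.Sort.MergeSort.Properties ≤-decTotalOrder using (sort-↭; sort-↗)
open import Data.Product using (∃-syntax; _,_; proj₁; proj₂)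
open import Data.Sum using (inj₁; inj₂)
open import Data.Unit using (tt)
open import Function using (_∘_; id)
open import Relation.Binary.PropositionalEquality hiding (J)
open import Relation.Nullary
open import Relation.Nullary.Decidable using
  (does; dec-true; dec-false; from-yes; from-no; True; toWitness; fromWitness)
open import Relation.Unary using () renaming (Decidable to Decidable₁)

-- Sizes are reached only through counts. For p > q the weight of S grows with |S|, for p < q it
-- shrinks, so an upper bound for the weighted total, set against a lower bound for the plain number
-- of primitive sets, limits the share of extreme sizes. Both bounds are compared on one period of
-- 55296 integers with a factor 2 to spare. Over s periods this factor becomes 2^s and absorbs the
-- constants that come from rounding and from n mod 55296. Total weight divided by q^length is
-- monotone under inclusion. Hence the pieces of the cover may overlap each other or the small
-- elements, at the price of tracking their volumes q^length. The small elements are set apart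
-- because chains of halvings get arbitrarily long: cutting them at a fixed length makes the shapes
-- periodic, and each element left out costs at most a factor p + q. A quarter instead of a half
-- keeps both middle entries of the sorted sizes away from the extremes, whatever the parity of
-- their number.

private variable
  P Q R : Set

-- Indicators of decidable propositions.

indicator : Dec P → ℕ
indicator a? = if does a? then 1 else 0

indicator-mono : (a? : Dec P) (b? : Dec Q) → (P → Q) → indicator a? ≤ indicator b?
indicator-mono (no _)  _       f = z≤n
indicator-mono (yes a) (yes _) f = ≤-refl
indicator-mono (yes a) (no ¬b) f = contradiction (f a) ¬b

indicator-cong : (a? : Dec P) (b? : Dec Q) → (P → Q) → (Q → P) → indicator a? ≡ indicator b?
indicator-cong a? b? f g = ≤-antisym (indicator-mono a? b? f) (indicator-mono b? a? g)

indicator-true : (a? : Dec P) → P → indicator a? ≡ 1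
indicator-true (yes _) a = refl
indicator-true (no ¬a) a = contradiction a ¬a

indicator-false : (a? : Dec P) → ¬ P → indicator a? ≡ 0
indicator-false (yes a) ¬a = contradiction a ¬a
indicator-false (no _)  ¬a = refl

indicator≤1 : (a? : Dec P) → indicator a? ≤ 1
indicator≤1 (yes _) = ≤-refl
indicator≤1 (no _)  = z≤n

if-does : (a? : Dec P) {m n : ℕ} → (P → m ≡ n) → (¬ P → m ≡ 0) → m ≡ (if does a? then n else 0)
if-does (yes a) f g = f a
if-does (no ¬a) f g = g ¬a

indicator-≤-* : (a? : Dec P) (b? : Dec Q) (c? : Dec R) → (P → Q × R) →
                indicator a? ≤ indicator b? * indicator c?
indicator-≤-* (no _)  _       _       f = z≤n
indicator-≤-* (yes _) (yes _) (yes _) f = ≤-refl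
indicator-≤-* (yes a) (no ¬b) _       f = contradiction (proj₁ (f a)) ¬b
indicator-≤-* (yes a) (yes _) (no ¬c) f = contradiction (proj₂ (f a)) ¬c

*-≤-indicator : (a? : Dec P) (b? : Dec Q) (c? : Dec R) → (Q → R → P) →
                indicator b? * indicator c? ≤ indicator a?
*-≤-indicator a?      (no _)  _       f = z≤n
*-≤-indicator a?      (yes _) (no _)  f = z≤n
*-≤-indicator (yes _) (yes _) (yes _) f = ≤-refl
*-≤-indicator (no ¬a) (yes b) (yes c) f = contradiction (f b c) ¬a

-- Primitive lists under permutation, splitting and scaling.

Incomparable : ℕ → ℕ → Set
Incomparable x y = ¬ (x ∣ y) × ¬ (y ∣ x)

Incomparable-sym : ∀ {x y} → Incomparable x y → Incomparable y x
Incomparable-sym (x∤y , y∤x) = y∤x , x∤y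

Primitive-resp-↭ : ∀ {xs ys} → xs ↭ ys → Primitive xs → Primitive ys
Primitive-resp-↭ xs↭ys = Permutation.AllPairs-resp-↭ (setoid ℕ)
  Incomparable-sym (subst _ , subst (λ x → Incomparable x _)) (↭⇒↭ₛ xs↭ys)

Primitive-++⁻ : ∀ xs {ys} → Primitive (xs ++ ys) → Primitive xs × Primitive ys
Primitive-++⁻ []       p        = [] , p
Primitive-++⁻ (x ∷ xs) (px ∷ p) with Primitive-++⁻ xs p
... | pxs , pys = All.++⁻ˡ xs px ∷ pxs , pys

Primitive-map-* : ∀ m .{{_ : NonZero m}} {xs} → Primitive xs → Primitive (map (m *_) xs)
Primitive-map-* m p = AllPairs.map⁺
  (AllPairs.map (λ (x∤y , y∤x) → (x∤y ∘ *-cancelˡ-∣ m) , (y∤x ∘ *-cancelˡ-∣ m)) p)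

Primitive-map-*⁻ : ∀ m {xs} → Primitive (map (m *_) xs) → Primitive xs
Primitive-map-*⁻ m p = AllPairs.map
  (λ (x∤y , y∤x) → (x∤y ∘ *-monoʳ-∣ m) , (y∤x ∘ *-monoʳ-∣ m)) (AllPairs.map⁻ p)

[primitive] : List ℕ → ℕ
[primitive] xs = indicator (primitive? xs)

infix 4 _RespectsPermutation
_RespectsPermutation : (List ℕ → ℕ) → Set
f RespectsPermutation = ∀ {S T} → S ↭ T → f S ≡ f T

[primitive]-resp-↭ : [primitive] RespectsPermutation
[primitive]-resp-↭ {S} {T} S↭T = indicator-cong (primitive? S) (primitive? T)
  (Primitive-resp-↭ S↭T) (Primitive-resp-↭ (↭-sym S↭T))

-- Each entry of `xs` removes one occurrence from `ys`; as `xs` has no repetitions, its later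
-- entries survive the removal. Repetitions in `ys` are allowed, which the overlapping cover needs.
Unique∧⊆⇒↭++ : ∀ {xs ys : List ℕ} → Unique xs → xs ⊆ ys → ∃[ zs ] ys ↭ xs ++ zs
Unique∧⊆⇒↭++ {[]}     {ys} _ _ = ys , ↭-refl
Unique∧⊆⇒↭++ {x ∷ xs} {ys} (x∉xs ∷ unique) xs⊆ys with ∈-∃++ (xs⊆ys (here refl))
... | as , bs , refl = proj₁ rec , ↭-trans (shift x as bs) (prep x (proj₂ rec))
  where
  xs⊆ : xs ⊆ as ++ bs
  xs⊆ z∈xs with ∈-resp-↭ (shift x as bs) (xs⊆ys (there z∈xs))
  ... | here z≡x  = contradiction (sym z≡x) (All.lookup x∉xs z∈xs)
  ... | there z∈  = z∈
  rec = Unique∧⊆⇒↭++ unique xs⊆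

-- Weighted sums over subsets and the total weight of primitive sets.

module WeightedSum (p q : ℕ) where

  -- Σ_{S ⊆ xs} p^|S| q^(|xs|−|S|) f(S)
  wsum : (List ℕ → ℕ) → List ℕ → ℕ
  wsum f []       = f []
  wsum f (x ∷ xs) = q * wsum f xs + p * wsum (f ∘ (x ∷_)) xs

  wsum-mono : ∀ {f g} xs → (∀ S → S ⊆ xs → f S ≤ g S) → wsum f xs ≤ wsum g xs
  wsum-mono []       f≤g = f≤g [] id
  wsum-mono (x ∷ xs) f≤g = +-mono-≤
    (*-monoʳ-≤ q (wsum-mono xs λ S S⊆ → f≤g S (there ∘ S⊆)))
    (*-monoʳ-≤ p (wsum-mono xs λ S S⊆ → f≤g (x ∷ S) (∷⁺ʳ x S⊆)))

  wsum-cong : ∀ {f g} xs → (∀ S → f S ≡ g S) → wsum f xs ≡ wsum g xs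
  wsum-cong []       f≡g = f≡g []
  wsum-cong (x ∷ xs) f≡g =
    cong₂ (λ a b → q * a + p * b) (wsum-cong xs f≡g) (wsum-cong xs (f≡g ∘ (x ∷_)))

  wsum-*ˡ : ∀ c f xs → wsum (λ S → c * f S) xs ≡ c * wsum f xs
  wsum-*ˡ c f []       = refl
  wsum-*ˡ c f (x ∷ xs) rewrite wsum-*ˡ c f xs | wsum-*ˡ c (f ∘ (x ∷_)) xs =
    solve 5 (λ p q c a b → q :* (c :* a) :+ p :* (c :* b) := c :* (q :* a :+ p :* b)) refl
      p q c (wsum f xs) (wsum (f ∘ (x ∷_)) xs)
    where open +-*-Solver

  wsum-++ : ∀ f xs ys → wsum f (xs ++ ys) ≡ wsum (λ S → wsum (λ T → f (S ++ T)) ys) xs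
  wsum-++ f []       ys = refl
  wsum-++ f (x ∷ xs) ys =
    cong₂ (λ a b → q * a + p * b) (wsum-++ f xs ys) (wsum-++ (f ∘ (x ∷_)) xs ys)

  wsum-map : ∀ f h xs → wsum f (map h xs) ≡ wsum (f ∘ map h) xs
  wsum-map f h []       = refl
  wsum-map f h (x ∷ xs) =
    cong₂ (λ a b → q * a + p * b) (wsum-map f h xs) (wsum-map (f ∘ (h x ∷_)) h xs)

  wsum-↭ : ∀ {f xs ys} → f RespectsPermutation → xs ↭ ys → wsum f xs ≡ wsum f ys
  wsum-↭ resp refl          = refl
  wsum-↭ resp (prep x σ)    =
    cong₂ (λ a b → q * a + p * b) (wsum-↭ resp σ) (wsum-↭ (resp ∘ prep x) σ)
  wsum-↭ {f} {_ ∷ _ ∷ xs} {_ ∷ _ ∷ ys} resp (swap x y σ) = trans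
    (cong₂ (λ a b → q * a + p * b)
      (cong₂ (λ a b → q * a + p * b) (wsum-↭ resp σ) (wsum-↭ (resp ∘ prep y) σ))
      (cong₂ (λ a b → q * a + p * b) (wsum-↭ (resp ∘ prep x) σ)
        (trans (wsum-↭ (resp ∘ prep x ∘ prep y) σ)
               (wsum-cong ys λ S → resp (swap x y ↭-refl)))))
    (solve 6 (λ p q a b c d → q :* (q :* a :+ p :* b) :+ p :* (q :* c :+ p :* d)
                            := q :* (q :* a :+ p :* c) :+ p :* (q :* b :+ p :* d)) refl
      p q (wsum f ys) (wsum (f ∘ (y ∷_)) ys) (wsum (f ∘ (x ∷_)) ys) (wsum (f ∘ (y ∷_) ∘ (x ∷_)) ys))
    where open +-*-Solver
  wsum-↭ resp (σ ∙ τ)       = trans (wsum-↭ resp σ) (wsum-↭ resp τ)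

  wsum-≥-empty : ∀ f xs → q ^ length xs * f [] ≤ wsum f xs
  wsum-≥-empty f []       = ≤-reflexive (*-identityˡ _)
  wsum-≥-empty f (x ∷ xs) = begin
    q * q ^ length xs * f []    ≡⟨ *-assoc q _ _ ⟩
    q * (q ^ length xs * f [])  ≤⟨ *-monoʳ-≤ q (wsum-≥-empty f xs) ⟩
    q * wsum f xs               ≤⟨ m≤m+n _ _ ⟩
    wsum f (x ∷ xs)             ∎
    where open ≤-Reasoning

  wsum-≤-^ : ∀ {f} xs → (∀ S → f S ≤ 1) → wsum f xs ≤ (p + q) ^ length xs
  wsum-≤-^ []       f≤1 = f≤1 []
  wsum-≤-^ {f} (x ∷ xs) f≤1 = begin
    q * wsum f xs + p * wsum (f ∘ (x ∷_)) xs
      ≤⟨ +-mono-≤ (*-monoʳ-≤ q (wsum-≤-^ xs f≤1)) (*-monoʳ-≤ p (wsum-≤-^ xs (f≤1 ∘ (x ∷_)))) ⟩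
    q * (p + q) ^ length xs + p * (p + q) ^ length xs
      ≡⟨ +-comm (q * (p + q) ^ length xs) _ ⟩
    p * (p + q) ^ length xs + q * (p + q) ^ length xs
      ≡⟨ *-distribʳ-+ ((p + q) ^ length xs) p q ⟨
    (p + q) ^ length (x ∷ xs) ∎
    where open ≤-Reasoning

  -- Connects the enumeration `subsets` with the recursion of `wsum`. The bound on `length S` keeps
  -- the truncated subtraction exact when an element is added to `xs`.
  sum-subsets≤wsum : ∀ {h f} xs →
    (∀ S → length S ≤ length xs → h S ≤ p ^ length S * q ^ (length xs ∸ length S) * f S) →
    sum (map h (subsets xs)) ≤ wsum f xs
  sum-subsets≤wsum {h} {f} [] h≤ = begin
    h [] + 0   ≡⟨ +-identityʳ _ ⟩
    h []       ≤⟨ h≤ [] z≤n ⟩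
    1 * f []   ≡⟨ *-identityˡ _ ⟩
    f []       ∎
    where open ≤-Reasoning
  sum-subsets≤wsum {h} {f} (x ∷ xs) h≤ = begin
    sum (map h (subsets xs ++ map (x ∷_) (subsets xs)))
      ≡⟨ cong sum (map-++ h (subsets xs) _) ⟩
    sum (map h (subsets xs) ++ map h (map (x ∷_) (subsets xs)))
      ≡⟨ sum-++ (map h (subsets xs)) _ ⟩
    sum (map h (subsets xs)) + sum (map h (map (x ∷_) (subsets xs)))
      ≡⟨ cong (λ l → sum (map h (subsets xs)) + sum l) (map-∘ (subsets xs)) ⟨
    sum (map h (subsets xs)) + sum (map (h ∘ (x ∷_)) (subsets xs))
      ≤⟨ +-mono-≤ (sum-subsets≤wsum xs without) (sum-subsets≤wsum xs with′) ⟩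
    wsum (λ S → q * f S) xs + wsum (λ S → p * f (x ∷ S)) xs
      ≡⟨ cong₂ _+_ (wsum-*ˡ q f xs) (wsum-*ˡ p (f ∘ (x ∷_)) xs) ⟩
    wsum f (x ∷ xs) ∎
    where
    open ≤-Reasoning
    open +-*-Solver
    without : ∀ S → length S ≤ length xs →
      h S ≤ p ^ length S * q ^ (length xs ∸ length S) * (q * f S)
    without S S≤ = begin
      h S                                                         ≤⟨ h≤ S (m≤n⇒m≤1+n S≤) ⟩
      p ^ length S * q ^ (suc (length xs) ∸ length S) * f S
        ≡⟨ cong (λ e → p ^ length S * q ^ e * f S) (+-∸-assoc 1 S≤) ⟩
      p ^ length S * (q * q ^ (length xs ∸ length S)) * f S
        ≡⟨ solve 4 (λ a b c d → a :* (b :* c) :* d := a :* c :* (b :* d)) refl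
             (p ^ length S) q (q ^ (length xs ∸ length S)) (f S) ⟩
      p ^ length S * q ^ (length xs ∸ length S) * (q * f S)       ∎
    with′ : ∀ S → length S ≤ length xs →
      h (x ∷ S) ≤ p ^ length S * q ^ (length xs ∸ length S) * (p * f (x ∷ S))
    with′ S S≤ = begin
      h (x ∷ S)                                                   ≤⟨ h≤ (x ∷ S) (s≤s S≤) ⟩
      p * p ^ length S * q ^ (length xs ∸ length S) * f (x ∷ S)
        ≡⟨ solve 4 (λ a b c d → b :* a :* c :* d := a :* c :* (b :* d)) refl
             (p ^ length S) p (q ^ (length xs ∸ length S)) (f (x ∷ S)) ⟩
      p ^ length S * q ^ (length xs ∸ length S) * (p * f (x ∷ S)) ∎

  primSum : List ℕ → ℕ
  primSum = wsum [primitive]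

  primSum-≤-^ : ∀ xs → primSum xs ≤ (p + q) ^ length xs
  primSum-≤-^ xs = wsum-≤-^ xs (indicator≤1 ∘ primitive?)

  -- Both parts of a primitive set are primitive; the loss comes from forgetting the divisibilities
  -- between `xs` and `ys`.
  primSum-++-≤ : ∀ xs ys → primSum (xs ++ ys) ≤ primSum xs * primSum ys
  primSum-++-≤ xs ys = begin
    primSum (xs ++ ys)                                           ≡⟨ wsum-++ [primitive] xs ys ⟩
    wsum (λ S → wsum (λ T → [primitive] (S ++ T)) ys) xs
      ≤⟨ wsum-mono xs (λ S _ → wsum-mono ys (λ T _ →
           indicator-≤-* (primitive? (S ++ T)) (primitive? S) (primitive? T) (Primitive-++⁻ S))) ⟩
    wsum (λ S → wsum (λ T → [primitive] S * [primitive] T) ys) xs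
      ≡⟨ wsum-cong xs (λ S → wsum-*ˡ ([primitive] S) [primitive] ys) ⟩
    wsum (λ S → [primitive] S * primSum ys) xs
      ≡⟨ wsum-cong xs (λ S → *-comm ([primitive] S) _) ⟩
    wsum (λ S → primSum ys * [primitive] S) xs                   ≡⟨ wsum-*ˡ (primSum ys) [primitive] xs ⟩
    primSum ys * primSum xs                                      ≡⟨ *-comm (primSum ys) _ ⟩
    primSum xs * primSum ys                                      ∎
    where open ≤-Reasoning

  -- With no divisibility across, any two primitive parts combine to a primitive set.
  primSum-++-≥ : ∀ xs ys → (∀ {x y} → x ∈ xs → y ∈ ys → Incomparable x y) →
                 primSum xs * primSum ys ≤ primSum (xs ++ ys)
  primSum-++-≥ xs ys incomparable = begin
    primSum xs * primSum ys                                      ≡⟨ *-comm (primSum xs) _ ⟩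
    primSum ys * primSum xs                                      ≡⟨ wsum-*ˡ (primSum ys) [primitive] xs ⟨
    wsum (λ S → primSum ys * [primitive] S) xs
      ≡⟨ wsum-cong xs (λ S → *-comm (primSum ys) _) ⟩
    wsum (λ S → [primitive] S * primSum ys) xs
      ≡⟨ wsum-cong xs (λ S → wsum-*ˡ ([primitive] S) [primitive] ys) ⟨
    wsum (λ S → wsum (λ T → [primitive] S * [primitive] T) ys) xs
      ≤⟨ wsum-mono xs (λ S S⊆ → wsum-mono ys (λ T T⊆ →
           *-≤-indicator (primitive? (S ++ T)) (primitive? S) (primitive? T) λ pS pT →
             AllPairs.++⁺ pS pT (All.tabulate λ x∈ → All.tabulate λ y∈ →
               incomparable (S⊆ x∈) (T⊆ y∈)))) ⟩
    wsum (λ S → wsum (λ T → [primitive] (S ++ T)) ys) xs         ≡⟨ wsum-++ [primitive] xs ys ⟨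
    primSum (xs ++ ys)                                           ∎
    where open ≤-Reasoning

  primSum-concat-≤ : ∀ {I : Set} (piece : I → List ℕ) is →
    primSum (concat (map piece is)) ≤ product (map (primSum ∘ piece) is)
  primSum-concat-≤ piece []       = ≤-refl
  primSum-concat-≤ piece (i ∷ is) = begin
    primSum (piece i ++ concat (map piece is))         ≤⟨ primSum-++-≤ (piece i) _ ⟩
    primSum (piece i) * primSum (concat (map piece is)) ≤⟨ *-monoʳ-≤ (primSum (piece i)) (primSum-concat-≤ piece is) ⟩
    product (map (primSum ∘ piece) (i ∷ is))           ∎
    where open ≤-Reasoning

  primSum-map-* : ∀ m .{{_ : NonZero m}} xs → primSum (map (m *_) xs) ≡ primSum xs
  primSum-map-* m xs = trans (wsum-map [primitive] (m *_) xs)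
    (wsum-cong xs λ S → indicator-cong (primitive? (map (m *_) S)) (primitive? S)
      (Primitive-map-*⁻ m) (Primitive-map-* m))

  -- Cross-multiplied monotonicity of `primSum xs / q ^ length xs`: among the subsets of `ys`, only
  -- those that avoid the surplus entries `zs` are kept, and these contribute
  -- `q ^ length zs * primSum xs`.
  primSum-⊆ : ∀ {xs ys} → Unique xs → xs ⊆ ys →
              primSum xs * q ^ length ys ≤ primSum ys * q ^ length xs
  primSum-⊆ {xs} {ys} unique xs⊆ys with Unique∧⊆⇒↭++ unique xs⊆ys
  ... | zs , σ = begin
    primSum xs * q ^ length ys
      ≡⟨ cong (λ l → primSum xs * q ^ l) (trans (↭-length σ) (length-++ xs)) ⟩
    primSum xs * q ^ (length xs + length zs)
      ≡⟨ cong (primSum xs *_) (^-distribˡ-+-* q (length xs) (length zs)) ⟩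
    primSum xs * (q ^ length xs * q ^ length zs)
      ≡⟨ solve 3 (λ a b c → a :* (b :* c) := c :* a :* b) refl (primSum xs) (q ^ length xs) (q ^ length zs) ⟩
    q ^ length zs * primSum xs * q ^ length xs
      ≤⟨ *-monoˡ-≤ (q ^ length xs) extend ⟩
    primSum (xs ++ zs) * q ^ length xs
      ≡⟨ cong (_* q ^ length xs) (wsum-↭ [primitive]-resp-↭ σ) ⟨
    primSum ys * q ^ length xs ∎
    where
    open ≤-Reasoning
    open +-*-Solver
    extend : q ^ length zs * primSum xs ≤ primSum (xs ++ zs)
    extend = begin
      q ^ length zs * primSum xs
        ≡⟨ wsum-*ˡ (q ^ length zs) [primitive] xs ⟨
      wsum (λ S → q ^ length zs * [primitive] S) xs
        ≡⟨ wsum-cong xs (λ S → cong (λ T → q ^ length zs * [primitive] T) (++-identityʳ S)) ⟨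
      wsum (λ S → q ^ length zs * [primitive] (S ++ [])) xs
        ≤⟨ wsum-mono xs (λ S _ → wsum-≥-empty (λ T → [primitive] (S ++ T)) zs) ⟩
      wsum (λ S → wsum (λ T → [primitive] (S ++ T)) zs) xs
        ≡⟨ wsum-++ [primitive] xs zs ⟨
      primSum (xs ++ zs) ∎

  -- Enumerates the antichains only, so that it can be run on posets with many subsets.
  antichainSum : (chosen rest : List ℕ) → ℕ
  antichainSum chosen []       = 1
  antichainSum chosen (x ∷ xs) =
    q * antichainSum chosen xs + p * (if does (primitive? (x ∷ chosen)) then antichainSum (x ∷ chosen) xs else 0)

  -- The reversed append appears because `antichainSum` puts each newly chosen element in front.
  wsum≡antichainSum : ∀ chosen xs → Primitive chosen →
    wsum (λ S → [primitive] (S ʳ++ chosen)) xs ≡ antichainSum chosen xs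
  wsum≡antichainSum chosen []       prim = indicator-true (primitive? chosen) prim
  wsum≡antichainSum chosen (x ∷ xs) prim = cong₂ (λ a b → q * a + p * b)
    (wsum≡antichainSum chosen xs prim)
    (if-does (primitive? (x ∷ chosen))
      (wsum≡antichainSum (x ∷ chosen) xs)
      -- Pruning is sound: every extension of a non-primitive choice is non-primitive, so the whole
      -- branch sums to 0.
      (λ ¬prim → trans
        (wsum-cong xs λ S → indicator-false (primitive? (S ʳ++ x ∷ chosen)) (¬prim ∘ ʳ++⁻ S))
        (wsum-*ˡ 0 [primitive] xs)))
    where
    ʳ++⁻ : ∀ S {T} → Primitive (S ʳ++ T) → Primitive T
    ʳ++⁻ []      p = p
    ʳ++⁻ (y ∷ S) p with ʳ++⁻ S p
    ... | _ ∷ pT = pT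

  primSum≡antichainSum : ∀ xs → primSum xs ≡ antichainSum [] xs
  primSum≡antichainSum xs = trans
    (wsum-cong xs λ S → [primitive]-resp-↭ (↭-sym (↭-reverse S)))
    (wsum≡antichainSum [] xs [])

primSum-mono-⊆ : ∀ {xs ys} → Unique xs → xs ⊆ ys → WeightedSum.primSum 1 1 xs ≤ WeightedSum.primSum 1 1 ys
primSum-mono-⊆ {xs} {ys} unique xs⊆ys = begin
  primSum xs                     ≡⟨ *-identityʳ _ ⟨
  primSum xs * 1                 ≡⟨ cong (primSum xs *_) (^-zeroˡ (length ys)) ⟨
  primSum xs * 1 ^ length ys     ≤⟨ primSum-⊆ unique xs⊆ys ⟩
  primSum ys * 1 ^ length xs     ≡⟨ cong (primSum ys *_) (^-zeroˡ (length xs)) ⟩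
  primSum ys * 1                 ≡⟨ *-identityʳ _ ⟩
  primSum ys                     ∎
  where
  open ≤-Reasoning
  open WeightedSum 1 1

if-elim : ∀ {A X : Set} (P : X → Set) (a? : Dec A) {t e : X} →
          (A → P t) → (¬ A → P e) → P (if does a? then t else e)
if-elim P (yes a) f g = f a
if-elim P (no ¬a) f g = g ¬a

if-cong : ∀ {A X Y : Set} (f : X → Y) (a? : Dec A) {t e : X} {t′ e′ : Y} →
          (A → f t ≡ t′) → (¬ A → f e ≡ e′) → f (if does a? then t else e) ≡ (if does a? then t′ else e′)
if-cong f (yes a) p q = p a
if-cong f (no ¬a) p q = q ¬a

^-distribʳ-* : ∀ q a b → (a * b) ^ q ≡ a ^ q * b ^ q
^-distribʳ-* zero    a b = refl
^-distribʳ-* (suc q) a b rewrite ^-distribʳ-* q a b =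
  solve 4 (λ a b c d → a :* b :* (c :* d) := a :* c :* (b :* d)) refl a b (a ^ q) (b ^ q)
  where open +-*-Solver

-- Positions in sorted lists and the median.

All-nth : ∀ {P : ℕ → Set} {xs i} → All P xs → i < length xs → P (nth xs i)
All-nth {i = zero}  (px ∷ _)   _       = px
All-nth {i = suc i} (_  ∷ pxs) (s≤s i<) = All-nth pxs i<

module _ {P : ℕ → Set} (P? : Decidable₁ P) where

  countP : List ℕ → ℕ
  countP = length ∘ filter P?

  countP-all : ∀ {xs} → All P xs → countP xs ≡ length xs
  countP-all pxs = cong length (filter-all P? pxs)

  -- In a sorted list the entries satisfying a downward closed property form an initial segment, of
  -- length `countP xs`.
  nth-after : (∀ {x y} → x ≤ y → P y → P x) → ∀ {xs i} → AllPairs _≤_ xs →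
              i < length xs → countP xs ≤ i → ¬ P (nth xs i)
  nth-after down {x ∷ xs} {i} (x≤xs ∷ sorted) i< count≤ with P? x
  nth-after down {x ∷ xs} {zero}  (x≤xs ∷ sorted) i< ()           | yes _
  nth-after down {x ∷ xs} {suc i} (x≤xs ∷ sorted) (s≤s i<) (s≤s count≤) | yes _ =
    nth-after down sorted i< count≤
  nth-after down {x ∷ xs} {zero}  (x≤xs ∷ sorted) i< count≤       | no ¬px = ¬px
  nth-after down {x ∷ xs} {suc i} (x≤xs ∷ sorted) (s≤s i<) count≤ | no ¬px =
    ¬px ∘ down (All-nth x≤xs i<)

  -- Dually, an upward closed property holds exactly on a final segment.
  nth-before : (∀ {x y} → x ≤ y → P x → P y) → ∀ {xs i} → AllPairs _≤_ xs →
               countP xs + i < length xs → ¬ P (nth xs i)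
  nth-before up {x ∷ xs} {zero}  (x≤xs ∷ sorted) count< px = <-irrefl
    (trans (+-identityʳ _) (countP-all (px ∷ All.map (λ x≤y → up x≤y px) x≤xs))) count<
  nth-before up {x ∷ xs} {suc i} (x≤xs ∷ sorted) count< = nth-before up sorted (≤-pred (begin
    suc (suc (countP xs + i))       ≡⟨ cong suc (+-suc (countP xs) i) ⟨
    suc (countP xs + suc i)         ≤⟨ s≤s (+-monoˡ-≤ (suc i) count-tail) ⟩
    suc (countP (x ∷ xs) + suc i)   ≤⟨ count< ⟩
    suc (length xs)                 ∎))
    where
    open ≤-Reasoning
    count-tail : countP xs ≤ countP (x ∷ xs)
    count-tail with P? x
    ... | yes _ = n≤1+n _
    ... | no _  = ≤-refl

sizes : ℕ → List ℕ
sizes n = map length (primitiveSubsets n)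

sortedSizes-sorted : ∀ n → AllPairs _≤_ (sortedSizes n)
sortedSizes-sorted n = Sorted⇒AllPairs ≤-totalOrder (sort-↗ (sizes n))

countP-sortedSizes : ∀ {P : ℕ → Set} (P? : Decidable₁ P) n → countP P? (sortedSizes n) ≡ countP P? (sizes n)
countP-sortedSizes P? n = ↭-length (filter-↭ P? (sort-↭ (sizes n)))

primitiveCount : ℕ → ℕ
primitiveCount n = length (primitiveSubsets n)

length-sortedSizes : ∀ n → length (sortedSizes n) ≡ primitiveCount n
length-sortedSizes n = trans (↭-length (sort-↭ (sizes n))) (length-map length (primitiveSubsets n))

module _ (d D n : ℕ) where

  AtMost AtLeast : ℕ → Set
  AtMost  s = D * s ≤ d * n
  AtLeast s = d * n ≤ D * s

  atMost? : Decidable₁ AtMost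
  atMost? s = D * s ≤? d * n

  atLeast? : Decidable₁ AtLeast
  atLeast? s = d * n ≤? D * s

middle-before : ∀ {c m i} → 0 < m → 4 * c ≤ m → 2 * i ≤ m → c + i < m
middle-before {c} {m} {i} 0<m 4c≤m 2i≤m = *-cancelˡ-< 4 _ _ (begin-strict
  4 * (c + i)        ≡⟨ solve 2 (λ c i → con 4 :* (c :+ i) := con 4 :* c :+ con 2 :* (con 2 :* i)) refl c i ⟩
  4 * c + 2 * (2 * i) ≤⟨ +-mono-≤ 4c≤m (*-monoʳ-≤ 2 2i≤m) ⟩
  3 * m              <⟨ *-monoˡ-< m {{>-nonZero 0<m}} {3} {4} (n<1+n 3) ⟩
  4 * m              ∎)
  where
  open ≤-Reasoning
  open +-*-Solver

middle-after : ∀ {c m} → 0 < m → 4 * c ≤ m → c ≤ (m ∸ 1) / 2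
middle-after {c} {suc m} _ 4c≤m = begin
  c             ≡⟨ m*n/n≡m c 2 ⟨
  c * 2 / 2     ≤⟨ /-monoˡ-≤ 2 (2c≤ c 4c≤m) ⟩
  m / 2         ∎
  where
  open ≤-Reasoning
  open +-*-Solver
  -- For c at least 1, 2c + 1 ≤ 4c, which pays for the 1 subtracted before halving; c = 0 has to be
  -- separated.
  2c≤ : ∀ c → 4 * c ≤ suc m → c * 2 ≤ m
  2c≤ zero    _ = z≤n
  2c≤ (suc c) h = ≤-pred (begin
    suc (suc c * 2)          ≤⟨ m≤m+n _ (1 + 2 * c) ⟩
    suc (suc c * 2) + (1 + 2 * c)
      ≡⟨ solve 1 (λ c → con 1 :+ (con 1 :+ c) :* con 2 :+ (con 1 :+ con 2 :* c) := con 4 :* (con 1 :+ c)) refl c ⟩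
    4 * suc c                ≤⟨ h ⟩
    suc m                    ∎)

module _ (d D n : ℕ) (nonempty : 0 < primitiveCount n) where

  private
    xs = sortedSizes n
    m  = primitiveCount n

    0<len : 0 < length xs
    0<len = subst (0 <_) (sym (length-sortedSizes n)) nonempty

    2i≤ : 2 * (length xs / 2) ≤ length xs
    2i≤ = ≤-trans (≤-reflexive (*-comm 2 (length xs / 2))) (m/n*n≤m (length xs) 2)

    2i′≤ : 2 * ((length xs ∸ 1) / 2) ≤ length xs
    2i′≤ = ≤-trans (*-monoʳ-≤ 2 (/-monoˡ-≤ 2 (m∸n≤m (length xs) 1))) 2i≤

  -- Both middle entries lie beyond the initial segment of small sizes, so their sum is bounded
  -- without distinguishing parities.
  twiceν-> : 4 * countP (atMost? d D n) (sizes n) ≤ m → (d + d) * n < D * twiceν n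
  twiceν-> few = begin-strict
    (d + d) * n        ≡⟨ *-distribʳ-+ n d d ⟩
    d * n + d * n
      <⟨ +-mono-< (large ((length xs ∸ 1) / 2) 2i′≤ (middle-after 0<len few′))
                  (large (length xs / 2) 2i≤
                    (≤-trans (middle-after 0<len few′) (/-monoˡ-≤ 2 (m∸n≤m (length xs) 1)))) ⟩
    D * nth xs ((length xs ∸ 1) / 2) + D * nth xs (length xs / 2)
      ≡⟨ *-distribˡ-+ D (nth xs ((length xs ∸ 1) / 2)) (nth xs (length xs / 2)) ⟨
    D * twiceν n       ∎
    where
    open ≤-Reasoning
    few′ : 4 * countP (atMost? d D n) xs ≤ length xs
    few′ = subst₂ (λ c l → 4 * c ≤ l) (sym (countP-sortedSizes (atMost? d D n) n))
                                      (sym (length-sortedSizes n)) few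
    large : ∀ i → 2 * i ≤ length xs → countP (atMost? d D n) xs ≤ i → d * n < D * nth xs i
    -- `middle-before` with c = 0 only certifies that i is a position of the list; past its end
    -- `nth` would return the default 0.
    large i 2i≤ c≤i = ≰⇒> (nth-after (atMost? d D n) (λ x≤y Dy≤ → ≤-trans (*-monoʳ-≤ D x≤y) Dy≤)
      (sortedSizes-sorted n) ((middle-before {0} {_} {i} 0<len z≤n 2i≤)) c≤i)

  twiceν-< : 4 * countP (atLeast? d D n) (sizes n) ≤ m → D * twiceν n < (d + d) * n
  twiceν-< few = begin-strict
    D * twiceν n
      ≡⟨ *-distribˡ-+ D (nth xs ((length xs ∸ 1) / 2)) (nth xs (length xs / 2)) ⟩
    D * nth xs ((length xs ∸ 1) / 2) + D * nth xs (length xs / 2)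
      <⟨ +-mono-< (small ((length xs ∸ 1) / 2) 2i′≤) (small (length xs / 2) 2i≤) ⟩
    d * n + d * n      ≡⟨ *-distribʳ-+ n d d ⟨
    (d + d) * n        ∎
    where
    open ≤-Reasoning
    few′ : 4 * countP (atLeast? d D n) xs ≤ length xs
    few′ = subst₂ (λ c l → 4 * c ≤ l) (sym (countP-sortedSizes (atLeast? d D n) n))
                                      (sym (length-sortedSizes n)) few
    small : ∀ i → 2 * i ≤ length xs → D * nth xs i < d * n
    small i 2i≤ = ≰⇒> (nth-before (atLeast? d D n) (λ x≤y ≤Dx → ≤-trans ≤Dx (*-monoʳ-≤ D x≤y))
      (sortedSizes-sorted n) (middle-before {countP (atLeast? d D n) xs} {_} {i} 0<len few′ 2i≤))

-- Markov's inequality for the sizes of primitive sets.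

sum-map-indicator : ∀ {A : Set} {P : A → Set} (P? : Decidable₁ P) xs →
  length (filter P? xs) ≡ sum (map (indicator ∘ P?) xs)
sum-map-indicator P? []       = refl
sum-map-indicator P? (x ∷ xs) with P? x
... | yes _ = cong suc (sum-map-indicator P? xs)
... | no _  = sum-map-indicator P? xs

sum-map-*ˡ : ∀ {A : Set} c (f : A → ℕ) xs → sum (map (λ x → c * f x) xs) ≡ c * sum (map f xs)
sum-map-*ˡ c f []       = sym (*-zeroʳ c)
sum-map-*ˡ c f (x ∷ xs) = trans (cong (c * f x +_) (sum-map-*ˡ c f xs)) (sym (*-distribˡ-+ c (f x) _))

wsum-unweighted : ∀ f xs → WeightedSum.wsum 1 1 f xs ≡ sum (map f (subsets xs))
wsum-unweighted f []       = sym (+-identityʳ _)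
wsum-unweighted f (x ∷ xs) = begin
  1 * wsum f xs + 1 * wsum (f ∘ (x ∷_)) xs
    ≡⟨ cong₂ _+_ (*-identityˡ (wsum f xs)) (*-identityˡ (wsum (f ∘ (x ∷_)) xs)) ⟩
  wsum f xs + wsum (f ∘ (x ∷_)) xs
    ≡⟨ cong₂ _+_ (wsum-unweighted f xs) (wsum-unweighted (f ∘ (x ∷_)) xs) ⟩
  sum (map f (subsets xs)) + sum (map (f ∘ (x ∷_)) (subsets xs))
    ≡⟨ cong (λ l → sum (map f (subsets xs)) + sum l) (map-∘ (subsets xs)) ⟩
  sum (map f (subsets xs)) + sum (map f (map (x ∷_) (subsets xs)))
    ≡⟨ sum-++ (map f (subsets xs)) _ ⟨
  sum (map f (subsets xs) ++ map f (map (x ∷_) (subsets xs)))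
    ≡⟨ cong sum (map-++ f (subsets xs) _) ⟨
  sum (map f (subsets (x ∷ xs))) ∎
  where
  open ≡-Reasoning
  open WeightedSum 1 1

primitiveCount≡primSum : ∀ n → primitiveCount n ≡ WeightedSum.primSum 1 1 (oneTo n)
primitiveCount≡primSum n = trans (sum-map-indicator primitive? (subsets (oneTo n)))
                                 (sym (wsum-unweighted [primitive] (oneTo n)))

countP-sizes : ∀ {P : ℕ → Set} (P? : Decidable₁ P) (Ss : List (List ℕ)) →
  countP P? (map length (filter primitive? Ss)) ≡
  sum (map (λ S → indicator (P? (length S)) * [primitive] S) Ss)
countP-sizes P? []       = refl
countP-sizes P? (S ∷ Ss) with primitive? S
... | no _  = trans (countP-sizes P? Ss) 
  (cong (_+ sum (map (λ S → indicator (P? (length S)) * [primitive] S) Ss))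
        (sym (*-zeroʳ (indicator (P? (length S))))))
... | yes _ with P? (length S)
...   | yes _ = cong suc (countP-sizes P? Ss)
...   | no _  = countP-sizes P? Ss

-- Each primitive set whose size satisfies P contributes at least W to the weighted total, and all
-- other contributions are nonnegative.
markov : ∀ {P : ℕ → Set} (P? : Decidable₁ P) p q W n →
  (∀ s → s ≤ n → P s → W ≤ p ^ s * q ^ (n ∸ s)) →
  W * countP P? (sizes n) ≤ WeightedSum.primSum p q (oneTo n)
markov P? p q W n W≤ = begin
  W * countP P? (sizes n)
    ≡⟨ cong (W *_) (countP-sizes P? (subsets (oneTo n))) ⟩
  W * sum (map h (subsets (oneTo n)))               ≡⟨ sum-map-*ˡ W h (subsets (oneTo n)) ⟨
  sum (map (λ S → W * h S) (subsets (oneTo n)))     ≤⟨ sum-subsets≤wsum (oneTo n) bound ⟩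
  primSum (oneTo n)                                 ∎
  where
  open ≤-Reasoning
  open WeightedSum p q
  h : List ℕ → ℕ
  h S = indicator (P? (length S)) * [primitive] S
  len : length (oneTo n) ≡ n
  len = length-applyUpTo suc n
  bound : ∀ S → length S ≤ length (oneTo n) →
    W * h S ≤ p ^ length S * q ^ (length (oneTo n) ∸ length S) * [primitive] S
  bound S S≤ rewrite len with P? (length S)
  ... | no _  rewrite *-zeroʳ W = z≤n
  ... | yes p = ≤-trans (≤-reflexive (cong (W *_) (*-identityˡ ([primitive] S))))
                        (*-monoˡ-≤ ([primitive] S) (W≤ (length S) S≤ p))

-- Intervals and products of periodic functions.

applyUpTo-cong : ∀ {A : Set} {f g : ℕ → A} → (∀ i → f i ≡ g i) → ∀ n → applyUpTo f n ≡ applyUpTo g n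
applyUpTo-cong f≡g zero    = refl
applyUpTo-cong f≡g (suc n) = cong₂ _∷_ (f≡g 0) (applyUpTo-cong (f≡g ∘ suc) n)

applyUpTo-+ : ∀ {A : Set} (f : ℕ → A) m n →
              applyUpTo f (m + n) ≡ applyUpTo f m ++ applyUpTo (λ i → f (m + i)) n
applyUpTo-+ f zero    n = refl
applyUpTo-+ f (suc m) n = cong (f 0 ∷_) (applyUpTo-+ (f ∘ suc) m n)

-- The integers of the half-open interval (a , a + n].
range : ℕ → ℕ → List ℕ
range a n = applyUpTo (λ i → suc (a + i)) n

range-++ : ∀ {a b} m n → a + m ≡ b → range a m ++ range b n ≡ range a (m + n)
range-++ {a} m n refl = sym (trans (applyUpTo-+ (λ i → suc (a + i)) m n)
  (cong (range a m ++_) (applyUpTo-cong (λ i → cong suc (sym (+-assoc a m i))) n)))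

∈-range⁺ : ∀ {a n x} → a < x → x ≤ a + n → x ∈ range a n
∈-range⁺ {a} {n} {suc x} (s≤s a≤x) x≤ = subst (_∈ range a n) (cong suc (m+[n∸m]≡n a≤x))
  (∈-applyUpTo⁺ (λ i → suc (a + i))
    (+-cancelˡ-< a _ _ (subst (_< a + n) (sym (m+[n∸m]≡n a≤x)) x≤)))

∈-range⁻ : ∀ {a n x} → x ∈ range a n → a < x × x ≤ a + n
∈-range⁻ {a} {n} x∈ with ∈-applyUpTo⁻ (λ i → suc (a + i)) x∈
... | i , i<n , refl = s≤s (m≤m+n a i) , ≤-trans (≤-reflexive (sym (+-suc a i))) (+-monoʳ-≤ a i<n)

range-unique : ∀ a n → Unique (range a n)
range-unique a n = Unique.applyUpTo⁺₁ (λ i → suc (a + i)) n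
  (λ i<j _ eq → <⇒≢ i<j (+-cancelˡ-≡ a _ _ (suc-injective eq)))

length-range : ∀ a n → length (range a n) ≡ n
length-range a = length-applyUpTo (λ i → suc (a + i))

Periodic : ℕ → (ℕ → ℕ) → Set
Periodic T g = ∀ v → g (T + v) ≡ g v

does-∣?-periodic : ∀ {d T} → d ∣ T → ∀ v → does (d ∣? (T + v)) ≡ does (d ∣? v)
does-∣?-periodic {d} d∣T v with d ∣? v
... | yes d∣v = dec-true (d ∣? _) (∣m∣n⇒∣m+n d∣T d∣v)
... | no d∤v  = dec-false (d ∣? _) (λ d∣ → d∤v (∣m+n∣m⇒∣n d∣ d∣T))

prodRange : (ℕ → ℕ) → ℕ → ℕ → ℕ
prodRange g a n = product (map g (range a n))

prodRange-+ : ∀ g {a b} m n → a + m ≡ b → prodRange g a (m + n) ≡ prodRange g a m * prodRange g b n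
prodRange-+ g {a} {b} m n eq = begin
  product (map g (range a (m + n)))                 ≡⟨ cong (product ∘ map g) (range-++ m n eq) ⟨
  product (map g (range a m ++ range b n))          ≡⟨ cong product (map-++ g (range a m) _) ⟩
  product (map g (range a m) ++ map g (range b n))  ≡⟨ product-++ (map g (range a m)) _ ⟩
  prodRange g a m * prodRange g b n                 ∎
  where open ≡-Reasoning

prodRange-shift : ∀ {g T} → Periodic T g → ∀ k n → prodRange g (k * T) n ≡ prodRange g 0 n
prodRange-shift         per zero    n = refl
prodRange-shift {g} {T} per (suc k) n = trans (cong product eq) (prodRange-shift per k n)
  where
  open ≡-Reasoning
  eq : map g (range (T + k * T) n) ≡ map g (range (k * T) n)
  eq = begin
    map g (range (T + k * T) n)                       ≡⟨ map-applyUpTo _ g n ⟩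
    applyUpTo (λ i → g (suc (T + k * T + i))) n
      ≡⟨ applyUpTo-cong (λ i → trans (cong g (trans (cong suc (+-assoc T (k * T) i)) (sym (+-suc T _)))) (per _)) n ⟩
    applyUpTo (λ i → g (suc (k * T + i))) n           ≡⟨ map-applyUpTo _ g n ⟨
    map g (range (k * T) n)                           ∎

-- prodRange g 0 n, in a form that evaluates in linear time.
prodUpTo : (ℕ → ℕ) → ℕ → ℕ
prodUpTo g zero    = 1
prodUpTo g (suc n) = g (suc n) * prodUpTo g n

prodRange≡prodUpTo : ∀ g n → prodRange g 0 n ≡ prodUpTo g n
prodRange≡prodUpTo g zero    = refl
prodRange≡prodUpTo g (suc n) = begin
  prodRange g 0 (suc n)               ≡⟨ cong (prodRange g 0) (+-comm 1 n) ⟩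
  prodRange g 0 (n + 1)               ≡⟨ prodRange-+ g n 1 refl ⟩
  prodRange g 0 n * prodRange g n 1   ≡⟨ cong₂ _*_ (prodRange≡prodUpTo g n) (trans (*-identityʳ _) (cong (g ∘ suc) (+-identityʳ n))) ⟩
  prodUpTo g n * g (suc n)            ≡⟨ *-comm (prodUpTo g n) _ ⟩
  prodUpTo g (suc n)                  ∎
  where open ≡-Reasoning

prodUpTo≢0 : ∀ {g} → (∀ v → NonZero (g v)) → ∀ n → NonZero (prodUpTo g n)
prodUpTo≢0 g≢0 zero    = _
prodUpTo≢0 g≢0 (suc n) = m*n≢0 _ _ {{g≢0 (suc n)}} {{prodUpTo≢0 g≢0 n}}

prodRange-periodic : ∀ {g T a} → Periodic T g → T ∣ a → ∀ q → prodRange g a (q * T) ≡ prodUpTo g T ^ q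
prodRange-periodic per T∣a zero = refl
prodRange-periodic {g} {T} {a} per T∣a@(divides k refl) (suc q) = trans
  (prodRange-+ g T (q * T) refl)
  (cong₂ _*_ (trans (prodRange-shift per k T) (prodRange≡prodUpTo g T))
             (prodRange-periodic per (∣m∣n⇒∣m+n T∣a n∣n) q))

-- Lower bound: components of the divisibility graph above n/4.

-- Here key labels the components of the divisibility graph on the integers in range.
module Keyed (InRange : ℕ → Set) (key : ℕ → ℕ)
             (key-∣ : ∀ {x y} → InRange x → InRange y → x ∣ y → key x ≡ key y) where

  open WeightedSum 1 1

  Block : ℕ × List ℕ → Set
  Block (k , xs) = Unique xs × All (λ x → InRange x × key x ≡ k) xs

  elements : List (ℕ × List ℕ) → List ℕ
  elements bs = concat (map proj₂ bs)

  elements-keys : ∀ {bs} → All Block bs → ∀ {x} → x ∈ elements bs → InRange x × key x ∈ map proj₁ bs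
  elements-keys {(k , xs) ∷ bs} ((_ , ok) ∷ oks) x∈ with ∈-++⁻ xs x∈
  ... | inj₁ x∈xs = proj₁ (All.lookup ok x∈xs) , here (proj₂ (All.lookup ok x∈xs))
  ... | inj₂ x∈bs = proj₁ (elements-keys oks x∈bs) , there (proj₂ (elements-keys oks x∈bs))

  keys-differ : ∀ {k xs bs} → All Block ((k , xs) ∷ bs) → All (k ≢_) (map proj₁ bs) →
                ∀ {x y} → x ∈ xs → y ∈ elements bs → InRange x × InRange y × key x ≢ key y
  keys-differ ((_ , ok) ∷ oks) k∉ x∈ y∈ =
    proj₁ (All.lookup ok x∈) , proj₁ (elements-keys oks y∈) ,
    λ eq → All.lookup k∉ (proj₂ (elements-keys oks y∈)) (trans (sym (proj₂ (All.lookup ok x∈))) eq)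

  elements-unique : ∀ {bs} → All Block bs → Unique (map proj₁ bs) → Unique (elements bs)
  elements-unique {[]}            _           _          = []
  elements-unique {(k , xs) ∷ bs} oks@((u , _) ∷ oks′) (k∉ ∷ us) =
    Unique.++⁺ u (elements-unique oks′ us)
      (λ (x∈ , y∈) → proj₂ (proj₂ (keys-differ oks k∉ x∈ y∈)) refl)

  product≤primSum : ∀ {bs} → All Block bs → Unique (map proj₁ bs) →
                    product (map (primSum ∘ proj₂) bs) ≤ primSum (elements bs)
  product≤primSum {[]}            _   _         = ≤-refl
  product≤primSum {(k , xs) ∷ bs} oks@(_ ∷ oks′) (k∉ ∷ us) = ≤-trans
    (*-monoʳ-≤ (primSum xs) (product≤primSum oks′ us))
    (primSum-++-≥ xs (elements bs) λ x∈ y∈ →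
      let xr , yr , x≢y = keys-differ oks k∉ x∈ y∈ in
      x≢y ∘ key-∣ xr yr , x≢y ∘ sym ∘ key-∣ yr xr)

  primSum-oneTo : ∀ {bs n} → All Block bs → Unique (map proj₁ bs) → (∀ {x} → InRange x → 0 < x × x ≤ n) →
                  product (map (primSum ∘ proj₂) bs) ≤ primSum (oneTo n)
  primSum-oneTo {bs} {n} oks us bounded = begin
    product (map (primSum ∘ proj₂) bs)                        ≤⟨ product≤primSum oks us ⟩
    primSum (elements bs)
      ≤⟨ primSum-mono-⊆ (elements-unique oks us) (λ x∈ → ∈-range⁺ {0}
           (proj₁ (bounded (proj₁ (elements-keys oks x∈))))
           (proj₂ (bounded (proj₁ (elements-keys oks x∈))))) ⟩
    primSum (oneTo n)                                         ∎
    where open ≤-Reasoning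

module TopThreeQuarters (q : ℕ) where

  open WeightedSum 1 1

  -- Here n = 24q. Above n/4 comparable elements have quotient 1, 2 or 3, and the factor 24 makes
  -- all cut points n/4, n/3, 3n/8, n/2, 3n/4 integers.
  InRange : ℕ → Set
  InRange x = 6 * q < x × x ≤ 24 * q

  -- The components of the divisibility graph on (6q , 24q] are {m, 2m, 3m} for m odd and
  -- {2h, 3h, 4h, 6h} below 8q, then {m, 2m} up to 12q, and singletons; their keys are the
  -- generators m, 2h, m and the element itself.
  keyMid : ℕ → ℕ
  keyMid y = if does (9 * q <? y) then (if does (3 ∣? y) then 2 * (y / 3) else y) else y

  key : ℕ → ℕ
  key x = if does (x ≤? 12 * q) then keyMid x else
          if does (2 ∣? x) then keyMid (x / 2) else
          if does (18 * q <? x) then (if does (3 ∣? x) then x / 3 else x) else x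

  keyMid-≤ : ∀ {y} → y ≤ 9 * q → keyMid y ≡ y
  keyMid-≤ {y} y≤ rewrite dec-false (9 * q <? y) (≤⇒≯ y≤) = refl

  keyMid-∤ : ∀ {y} → 3 ∤ y → keyMid y ≡ y
  keyMid-∤ {y} 3∤y rewrite dec-false (3 ∣? y) 3∤y with does (9 * q <? y)
  ... | true  = refl
  ... | false = refl

  keyMid-triple : ∀ {h} → 9 * q < h * 3 → keyMid (h * 3) ≡ 2 * h
  keyMid-triple {h} 9q< rewrite dec-true (9 * q <? h * 3) 9q< | dec-true (3 ∣? h * 3) (n∣m*n h) =
    cong (2 *_) (m*n/n≡m h 3)

  key-≤ : ∀ {x} → x ≤ 12 * q → key x ≡ keyMid x
  key-≤ {x} x≤ rewrite dec-true (x ≤? 12 * q) x≤ = refl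

  key-double : ∀ {y} → 12 * q < y * 2 → key (y * 2) ≡ keyMid y
  key-double {y} 12q< rewrite dec-false (y * 2 ≤? 12 * q) (<⇒≱ 12q<) | dec-true (2 ∣? y * 2) (n∣m*n y) =
    cong keyMid (m*n/n≡m y 2)

  key-odd-triple : ∀ {x} → 18 * q < x * 3 → 2 ∤ x * 3 → 12 * q < x * 3 → key (x * 3) ≡ x
  key-odd-triple {x} 18q< odd 12q< rewrite dec-false (x * 3 ≤? 12 * q) (<⇒≱ 12q<)
    | dec-false (2 ∣? x * 3) odd | dec-true (18 * q <? x * 3) 18q< | dec-true (3 ∣? x * 3) (n∣m*n x) =
    m*n/n≡m x 3

  key-odd-≤ : ∀ {x} → 12 * q < x → x ≤ 18 * q → 2 ∤ x → key x ≡ x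
  key-odd-≤ {x} 12q< x≤ odd rewrite dec-false (x ≤? 12 * q) (<⇒≱ 12q<)
    | dec-false (2 ∣? x) odd | dec-false (18 * q <? x) (≤⇒≯ x≤) = refl

  key-odd-∤ : ∀ {x} → 12 * q < x → 2 ∤ x → 3 ∤ x → key x ≡ x
  key-odd-∤ {x} 12q< odd 3∤x rewrite dec-false (x ≤? 12 * q) (<⇒≱ 12q<)
    | dec-false (2 ∣? x) odd | dec-false (3 ∣? x) 3∤x with does (18 * q <? x)
  ... | true  = refl
  ... | false = refl

  collect : ∀ c d → c * q * d ≡ (c * d) * q
  collect c d = trans (*-assoc c q d) (trans (cong (c *_) (*-comm q d)) (sym (*-assoc c d q)))

  scale-< : ∀ c d .{{_ : NonZero d}} {x} → c * q < x → c * d * q < x * d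
  scale-< c d {x} c< = subst (_< x * d) (collect c d) (*-monoˡ-< d c<)

  unscale-< : ∀ c d {x} → c * d * q < x * d → c * q < x
  unscale-< c d {x} c< = *-cancelʳ-< d _ _ (subst (_< x * d) (sym (collect c d)) c<)

  scale-≤ : ∀ c d {x} → x ≤ c * q → x * d ≤ c * d * q
  scale-≤ c d {x} ≤c = subst (x * d ≤_) (collect c d) (*-monoˡ-≤ d ≤c)

  unscale-≤ : ∀ c d .{{_ : NonZero d}} {x} → x * d ≤ c * d * q → x ≤ c * q
  unscale-≤ c d {x} ≤c = *-cancelʳ-≤ _ _ d (subst (x * d ≤_) (sym (collect c d)) ≤c)

  widen-≤ : ∀ c d {x} {c≤d : True (c ≤? d)} → x ≤ c * q → x ≤ d * q
  widen-≤ c d {c≤d = c≤d} x≤ = ≤-trans x≤ (*-monoˡ-≤ q (toWitness c≤d))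

  widen-< : ∀ c d {x} {c≤d : True (c ≤? d)} → d * q < x → c * q < x
  widen-< c d {c≤d = c≤d} <x = ≤-<-trans (*-monoˡ-≤ q (toWitness c≤d)) <x

  key-*2 : ∀ {x} → 6 * q < x → x ≤ 12 * q → key (x * 2) ≡ key x
  key-*2 {x} 6q< x≤ = trans (key-double {x} (scale-< 6 2 6q<)) (sym (key-≤ x≤))

  -- If 3x is odd, its key divides the 3 out directly. If x = 2h, then 3x = 6h is the double of 3h,
  -- and `keyMid` sends 3h back to 2h = x.
  key-*3 : ∀ {x} → 6 * q < x → x ≤ 8 * q → key (x * 3) ≡ key x
  key-*3 {x} 6q< x≤ = trans key-triple (sym (trans (key-≤ (widen-≤ 8 12 x≤)) (keyMid-≤ {x} (widen-≤ 8 9 x≤))))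
    where
    18q< : 18 * q < x * 3
    18q< = scale-< 6 3 6q<
    key-triple : key (x * 3) ≡ x
    key-triple with 2 ∣? x * 3
    ... | no odd = key-odd-triple {x} 18q< odd (widen-< 12 18 18q<)
    ... | yes 2∣3x with euclidsLemma x 3 prime[2] 2∣3x
    ...   | inj₂ 2∣3 = contradiction 2∣3 (from-no (2 ∣? 3))
    ...   | inj₁ (divides h refl) = begin
      key (h * 2 * 3)    ≡⟨ cong key swap-factors ⟩
      key (h * 3 * 2)    ≡⟨ key-double {h * 3} (widen-< 12 18 18q<′) ⟩
      keyMid (h * 3)     ≡⟨ keyMid-triple {h} (unscale-< 9 2 18q<′) ⟩
      2 * h              ≡⟨ *-comm 2 h ⟩
      h * 2              ∎
      where
      open ≡-Reasoning
      swap-factors : h * 2 * 3 ≡ h * 3 * 2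
      swap-factors = trans (*-assoc h 2 3) (sym (*-assoc h 3 2))
      18q<′ : 18 * q < h * 3 * 2
      18q<′ = subst (18 * q <_) swap-factors 18q<

  key-∣ : ∀ {x y} → InRange x → InRange y → x ∣ y → key x ≡ key y
  key-∣ (6q<x , _) (6q<y , y≤) (divides 0 refl) = contradiction 6q<y λ()
  key-∣ {x} (6q<x , _) (6q<y , y≤) (divides 1 refl) = cong key (sym (+-identityʳ x))
  key-∣ {x} (6q<x , _) (6q<y , y≤) (divides 2 refl) rewrite *-comm 2 x =
    sym (key-*2 6q<x (unscale-≤ 12 2 y≤))
  key-∣ {x} (6q<x , _) (6q<y , y≤) (divides 3 refl) rewrite *-comm 3 x =
    sym (key-*3 6q<x (unscale-≤ 8 3 y≤))
  -- A quotient of 4 or more would lift y above 24q.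
  key-∣ {x} (6q<x , _) (6q<y , y≤) (divides (suc (suc (suc (suc c)))) refl) = contradiction y≤ (<⇒≱ (begin-strict
    24 * q                    <⟨ scale-< 6 4 6q<x ⟩
    x * 4                     ≡⟨ *-comm x 4 ⟩
    4 * x                     ≤⟨ *-monoˡ-≤ x {4} (m≤m+n 4 c) ⟩
    (4 + c) * x               ∎))
    where open ≤-Reasoning

  open Keyed InRange key key-∣

  -- Each component is listed at its key. Integers that belong to the component of a smaller key get
  -- an empty piece, so that every region is indexed by a full interval and its counts are periodic.
  piece₁ piece₂ piece₃ piece₄ piece₅ : ℕ → List ℕ
  piece₁ k = if does (2 ∣? k) then map (k / 2 *_) (2 ∷ 3 ∷ 4 ∷ 6 ∷ []) else map (k *_) (1 ∷ 2 ∷ 3 ∷ [])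
  piece₂ k = map (k *_) (1 ∷ 2 ∷ [])
  piece₃ k = if does (3 ∣? k) then [] else map (k *_) (1 ∷ 2 ∷ [])
  piece₄ k = if does (2 ∣? k) then [] else map (k *_) (1 ∷ [])
  piece₅ k = if does (2 ∣? k) then [] else if does (3 ∣? k) then [] else map (k *_) (1 ∷ [])

  multiple : ∀ {k} a c → 6 * q < k → k ≤ a * q → {True (1 ≤? c)} → {True (a * c ≤? 24)} → InRange (k * c)
  multiple {k} a c 6q<k k≤ {1≤c} {ac≤24} =
    <-≤-trans 6q<k (m≤m*n k c {{>-nonZero (toWitness 1≤c)}}) ,
    widen-≤ (a * c) 24 {c≤d = ac≤24} (scale-≤ a c k≤)

  multiples-block : ∀ {k} a → 6 * q < k → k ≤ a * q → key k ≡ k →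
    ∀ cs → {True (unique? cs)} → {True (All.all? (1 ≤?_) cs)} → {True (All.all? (λ c → a * c ≤? 24) cs)} →
    Block (k , map (k *_) cs)
  multiples-block {k} a 6q<k k≤ key≡ cs {u} {1≤cs} {cs≤} =
    Unique.map⁺ (λ {x} {y} → *-cancelˡ-≡ x y k {{>-nonZero (m<n⇒0<n 6q<k)}}) (toWitness u) ,
    All.map⁺ (All.tabulate λ {c} c∈ →
      let 1≤c = All.lookup (toWitness 1≤cs) c∈
          r   = multiple a c 6q<k k≤ {fromWitness 1≤c} {fromWitness (All.lookup (toWitness cs≤) c∈)}
          k≤24 = ≤-trans (m≤m*n k c {{>-nonZero 1≤c}}) (proj₂ r)
      in r , trans (sym (key-∣ (6q<k , k≤24) r (m∣m*n c))) key≡)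

  empty-block : ∀ {k} → Block (k , [])
  empty-block = [] , []

  key-low : ∀ {k} → k ≤ 8 * q → key k ≡ k
  key-low {k} k≤ = trans (key-≤ (widen-≤ 8 12 k≤)) (keyMid-≤ {k} (widen-≤ 8 9 k≤))

  -- 3h is not a multiple of the key 2h; it is linked to it through their common multiple 6h.
  even-block : ∀ {h} → 3 * q < h → h ≤ 4 * q → Block (h * 2 , map (h *_) (2 ∷ 3 ∷ 4 ∷ 6 ∷ []))
  even-block {h} 3q<h h≤4q =
    Unique.map⁺ (λ {x} {y} → *-cancelˡ-≡ x y h {{>-nonZero (m<n⇒0<n 3q<h)}})
      (from-yes (unique? (2 ∷ 3 ∷ 4 ∷ 6 ∷ []))) ,
    All.map⁺ {xs = 2 ∷ 3 ∷ 4 ∷ 6 ∷ []} {f = h *_}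
             ((r 2 , key≡) ∷ (r 3 , trans (key-∣ (r 3) (r 6) (*-monoʳ-∣ h (divides 2 refl))) key6) ∷
              (r 4 , trans (sym (key-∣ (r 2) (r 4) (*-monoʳ-∣ h (divides 2 refl)))) key≡) ∷ (r 6 , key6) ∷ [])
    where
    r : ∀ c → {True (2 ≤? c)} → {True (6 ≤? 3 * c)} → {True (4 * c ≤? 24)} → InRange (h * c)
    r c {2≤c} {6≤} {≤24} =
      widen-< 6 (3 * c) {c≤d = 6≤} (scale-< 3 c {{>-nonZero (≤-trans (s≤s z≤n) (toWitness 2≤c))}} 3q<h) ,
      widen-≤ (4 * c) 24 {c≤d = ≤24} (scale-≤ 4 c h≤4q)
    key≡ : key (h * 2) ≡ h * 2
    key≡ = key-low (scale-≤ 4 2 h≤4q)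
    key6 : key (h * 6) ≡ h * 2
    key6 = trans (sym (key-∣ (r 2) (r 6) (*-monoʳ-∣ h (divides 3 refl)))) key≡

  block₁ : ∀ {k} → 6 * q < k → k ≤ 8 * q → Block (k , piece₁ k)
  block₁ {k} 6q<k k≤ = if-elim (λ xs → Block (k , xs)) (2 ∣? k) even
    (λ _ → multiples-block 8 6q<k k≤ (key-low k≤) (1 ∷ 2 ∷ 3 ∷ []))
    where
    even : 2 ∣ k → Block (k , map (k / 2 *_) (2 ∷ 3 ∷ 4 ∷ 6 ∷ []))
    even (divides h refl) = subst (λ m → Block (h * 2 , map (m *_) (2 ∷ 3 ∷ 4 ∷ 6 ∷ []))) (sym (m*n/n≡m h 2))
      (even-block {h} (unscale-< 3 2 6q<k) (unscale-≤ 4 2 k≤))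

  block₂ : ∀ {k} → 8 * q < k → k ≤ 9 * q → Block (k , piece₂ k)
  block₂ {k} 8q<k k≤ = multiples-block 9 (widen-< 6 8 8q<k) k≤
    (trans (key-≤ (widen-≤ 9 12 k≤)) (keyMid-≤ {k} k≤)) (1 ∷ 2 ∷ [])

  block₃ : ∀ {k} → 9 * q < k → k ≤ 12 * q → Block (k , piece₃ k)
  block₃ {k} 9q<k k≤ = if-elim (λ xs → Block (k , xs)) (3 ∣? k) (λ _ → empty-block)
    (λ 3∤k → multiples-block 12 (widen-< 6 9 9q<k) k≤ (trans (key-≤ k≤) (keyMid-∤ 3∤k)) (1 ∷ 2 ∷ []))

  block₄ : ∀ {k} → 12 * q < k → k ≤ 18 * q → Block (k , piece₄ k)
  block₄ {k} 12q<k k≤ = if-elim (λ xs → Block (k , xs)) (2 ∣? k) (λ _ → empty-block)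
    (λ odd → multiples-block 18 (widen-< 6 12 12q<k) k≤ (key-odd-≤ 12q<k k≤ odd) (1 ∷ []))

  block₅ : ∀ {k} → 18 * q < k → k ≤ 24 * q → Block (k , piece₅ k)
  block₅ {k} 18q<k k≤ = if-elim (λ xs → Block (k , xs)) (2 ∣? k) (λ _ → empty-block)
    (λ odd → if-elim (λ xs → Block (k , xs)) (3 ∣? k) (λ _ → empty-block)
      (λ 3∤k → multiples-block 24 (widen-< 6 18 18q<k) k≤ (key-odd-∤ (widen-< 12 18 18q<k) odd 3∤k) (1 ∷ [])))

  -- {2,3,4,6} has 8 primitive subsets, {1,2,3} has 5, {1,2} has 3 and a singleton has 2; an empty
  -- piece contributes 1.
  count₁ count₂ count₃ count₄ count₅ : ℕ → ℕ
  count₁ k = if does (2 ∣? k) then 8 else 5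
  count₂ k = 3
  count₃ k = if does (3 ∣? k) then 1 else 3
  count₄ k = if does (2 ∣? k) then 1 else 2
  count₅ k = if does (2 ∣? k) then 1 else if does (3 ∣? k) then 1 else 2

  primSum-multiples : ∀ {k} → 0 < k → ∀ cs → primSum (map (k *_) cs) ≡ primSum cs
  primSum-multiples {k} 0<k = primSum-map-* k {{>-nonZero 0<k}}

  primSum-piece₁ : ∀ {k} → 0 < k → primSum (piece₁ k) ≡ count₁ k
  primSum-piece₁ {k} 0<k = if-cong primSum (2 ∣? k) even (λ _ → primSum-multiples 0<k (1 ∷ 2 ∷ 3 ∷ []))
    where
    even : 2 ∣ k → primSum (map (k / 2 *_) (2 ∷ 3 ∷ 4 ∷ 6 ∷ [])) ≡ 8
    even (divides (suc h) refl) = trans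
      (cong (λ m → primSum (map (m *_) (2 ∷ 3 ∷ 4 ∷ 6 ∷ []))) (m*n/n≡m (suc h) 2))
      (primSum-map-* (suc h) (2 ∷ 3 ∷ 4 ∷ 6 ∷ []))

  primSum-piece₃ : ∀ {k} → 0 < k → primSum (piece₃ k) ≡ count₃ k
  primSum-piece₃ {k} 0<k = if-cong primSum (3 ∣? k) (λ _ → refl) (λ _ → primSum-multiples 0<k (1 ∷ 2 ∷ []))

  primSum-piece₄ : ∀ {k} → 0 < k → primSum (piece₄ k) ≡ count₄ k
  primSum-piece₄ {k} 0<k = if-cong primSum (2 ∣? k) (λ _ → refl) (λ _ → primSum-multiples 0<k (1 ∷ []))

  primSum-piece₅ : ∀ {k} → 0 < k → primSum (piece₅ k) ≡ count₅ k
  primSum-piece₅ {k} 0<k = if-cong primSum (2 ∣? k) (λ _ → refl) (λ _ →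
    if-cong primSum (3 ∣? k) (λ _ → refl) (λ _ → primSum-multiples 0<k (1 ∷ [])))

  region : (ℕ → List ℕ) → ℕ → ℕ → List (ℕ × List ℕ)
  region piece a n = map (λ k → k , piece k) (range a n)

  region-keys : ∀ piece a n → map proj₁ (region piece a n) ≡ range a n
  region-keys piece a n = trans (sym (map-∘ (range a n))) (map-id (range a n))

  region-blocks : ∀ {piece a n b} → a + n ≡ b → (∀ {k} → a < k → k ≤ b → Block (k , piece k)) →
                  All Block (region piece a n)
  region-blocks refl block = All.map⁺ (All.tabulate λ k∈ → let a<k , k≤ = ∈-range⁻ k∈ in block a<k k≤)

  region-product : ∀ {piece count T a} c → Periodic T count → T ∣ a → (∀ {k} → 0 < k → primSum (piece k) ≡ count k) →
    product (map (primSum ∘ proj₂) (region piece a (c * T))) ≡ prodUpTo count T ^ c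
  region-product {piece} {count} {T} {a} c per T∣a eq = begin
    product (map (primSum ∘ proj₂) (region piece a (c * T)))   ≡⟨ cong product (map-∘ (range a (c * T))) ⟨
    product (map (primSum ∘ piece) (range a (c * T)))
      ≡⟨ cong product (map-cong-local (All.tabulate λ k∈ → eq (m<n⇒0<n (proj₁ (∈-range⁻ {a} {c * T} k∈))))) ⟩
    prodRange count a (c * T)                                  ≡⟨ prodRange-periodic per T∣a c ⟩
    prodUpTo count T ^ c                                    ∎
    where open ≡-Reasoning

  -- The lengths are written as a number of repetitions times the period of the corresponding count
  -- (2, 1, 3, 2, 6), the form that `region-product` expects.
  blocks : List (ℕ × List ℕ)
  blocks = region piece₁ (6 * q) (q * 2) ++ region piece₂ (8 * q) (q * 1) ++ region piece₃ (9 * q) (q * 3) ++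
           region piece₄ (12 * q) (3 * q * 2) ++ region piece₅ (18 * q) (q * 6)

  private
    6q+2q : 6 * q + q * 2 ≡ 8 * q
    6q+2q = solve 1 (λ q → con 6 :* q :+ q :* con 2 := con 8 :* q) refl q where open +-*-Solver
    8q+q : 8 * q + q * 1 ≡ 9 * q
    8q+q = solve 1 (λ q → con 8 :* q :+ q :* con 1 := con 9 :* q) refl q where open +-*-Solver
    9q+3q : 9 * q + q * 3 ≡ 12 * q
    9q+3q = solve 1 (λ q → con 9 :* q :+ q :* con 3 := con 12 :* q) refl q where open +-*-Solver
    12q+6q : 12 * q + 3 * q * 2 ≡ 18 * q
    12q+6q = solve 1 (λ q → con 12 :* q :+ con 3 :* q :* con 2 := con 18 :* q) refl q where open +-*-Solver
    18q+6q : 18 * q + q * 6 ≡ 24 * q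
    18q+6q = solve 1 (λ q → con 18 :* q :+ q :* con 6 := con 24 :* q) refl q where open +-*-Solver

  blocks-ok : All Block blocks
  blocks-ok =
    All.++⁺ (region-blocks 6q+2q block₁) (All.++⁺ (region-blocks 8q+q block₂)
    (All.++⁺ (region-blocks 9q+3q block₃) (All.++⁺ (region-blocks 12q+6q block₄) (region-blocks 18q+6q block₅))))

  keys-++ : ∀ {piece a} m {bs b n} → a + m ≡ b → map proj₁ bs ≡ range b n →
            map proj₁ (region piece a m ++ bs) ≡ range a (m + n)
  keys-++ {piece} {a} m {bs} {b} {n} eq keys = trans (map-++ proj₁ (region piece a m) bs)
    (trans (cong₂ _++_ (region-keys piece a m) keys) (range-++ m n eq))

  blocks-unique : Unique (map proj₁ blocks)
  blocks-unique = subst Unique (sym (keys-++ (q * 2) 6q+2q (keys-++ (q * 1) 8q+q (keys-++ (q * 3) 9q+3q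
    (keys-++ (3 * q * 2) 12q+6q (region-keys piece₅ (18 * q) (q * 6))))))) (range-unique (6 * q) _)

  blocks-product : product (map (primSum ∘ proj₂) blocks) ≡ 34560 ^ q
  blocks-product = begin
    product (map F blocks)
      ≡⟨ product-map-++ (region piece₁ (6 * q) (q * 2))
           (region-product {piece₁} {count₁} q (λ v → cong (λ b → if b then 8 else 5) (does-∣?-periodic {2} n∣n v))
             (∣m⇒∣m*n q (divides 3 refl)) primSum-piece₁)
        (product-map-++ (region piece₂ (8 * q) (q * 1))
           (region-product {piece₂} {count₂} q (λ v → refl) (1∣ (8 * q)) (λ 0<k → primSum-multiples 0<k (1 ∷ 2 ∷ [])))
        (product-map-++ (region piece₃ (9 * q) (q * 3))
           (region-product {piece₃} {count₃} q (λ v → cong (λ b → if b then 1 else 3) (does-∣?-periodic {3} n∣n v))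
             (∣m⇒∣m*n q (divides 3 refl)) primSum-piece₃)
        (product-map-++ (region piece₄ (12 * q) (3 * q * 2))
           (region-product {piece₄} {count₄} (3 * q) (λ v → cong (λ b → if b then 1 else 2) (does-∣?-periodic {2} n∣n v))
             (∣m⇒∣m*n q (divides 6 refl)) primSum-piece₄)
           (region-product {piece₅} {count₅} q (λ v → cong₂ (λ b c → if b then 1 else if c then 1 else 2)
               (does-∣?-periodic {2} (divides 3 refl) v) (does-∣?-periodic {3} (divides 2 refl) v))
             (∣m⇒∣m*n q (divides 3 refl)) primSum-piece₅)))) ⟩
    -- The bases are products over one period: 8·5 modulo 2, then 3, then 1·3·3 modulo 3, then 1·2
    -- modulo 2, and 2·2 from the residues 1 and 5 modulo 6.
    40 ^ q * (3 ^ q * (9 ^ q * (2 ^ (3 * q) * 4 ^ q)))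
      ≡⟨ cong (λ x → 40 ^ q * (3 ^ q * (9 ^ q * (x * 4 ^ q)))) (^-*-assoc 2 3 q) ⟨
    40 ^ q * (3 ^ q * (9 ^ q * (8 ^ q * 4 ^ q)))
      ≡⟨ cong (λ x → 40 ^ q * (3 ^ q * (9 ^ q * x))) (^-distribʳ-* q 8 4) ⟨
    40 ^ q * (3 ^ q * (9 ^ q * 32 ^ q))     ≡⟨ cong (λ x → 40 ^ q * (3 ^ q * x)) (^-distribʳ-* q 9 32) ⟨
    40 ^ q * (3 ^ q * 288 ^ q)              ≡⟨ cong (40 ^ q *_) (^-distribʳ-* q 3 288) ⟨
    40 ^ q * 864 ^ q                        ≡⟨ ^-distribʳ-* q 40 864 ⟨
    34560 ^ q                               ∎
    where
    open ≡-Reasoning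
    F : ℕ × List ℕ → ℕ
    F = primSum ∘ proj₂
    product-map-++ : ∀ bs {cs m n} → product (map F bs) ≡ m → product (map F cs) ≡ n → product (map F (bs ++ cs)) ≡ m * n
    product-map-++ bs {cs} eq eq′ = trans (cong product (map-++ F bs cs))
      (trans (product-++ (map F bs) (map F cs)) (cong₂ _*_ eq eq′))

  34560^q≤primSum : 34560 ^ q ≤ primSum (oneTo (24 * q))
  34560^q≤primSum = subst (_≤ primSum (oneTo (24 * q))) blocks-product
    (primSum-oneTo blocks-ok blocks-unique λ (6q<x , x≤) → m<n⇒0<n 6q<x , x≤)

-- Powers of two and capped valuations.

^-monoʳ-∣ : ∀ b {m n} → m ≤ n → b ^ m ∣ b ^ n
^-monoʳ-∣ b {m} {n} m≤n = divides (b ^ (n ∸ m)) (begin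
  b ^ n                  ≡⟨ cong (b ^_) (m∸n+n≡m m≤n) ⟨
  b ^ (n ∸ m + m)        ≡⟨ ^-distribˡ-+-* b (n ∸ m) m ⟩
  b ^ (n ∸ m) * b ^ m    ∎)
  where open ≡-Reasoning

3∤m*2^n : ∀ {m} → 3 ∤ m → ∀ n → 3 ∤ m * 2 ^ n
3∤m*2^n {m} 3∤m n 3∣ with euclidsLemma m (2 ^ n) (from-yes (prime? 3)) 3∣
... | inj₁ 3∣m   = 3∤m 3∣m
... | inj₂ 3∣2^n = 3∤2^ n 3∣2^n
  where
  3∤2^ : ∀ n → 3 ∤ 2 ^ n
  3∤2^ zero    = from-no (3 ∣? 1)
  3∤2^ (suc n) 3∣ with euclidsLemma 2 (2 ^ n) (from-yes (prime? 3)) 3∣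
  ... | inj₁ 3∣2   = from-no (3 ∣? 2) 3∣2
  ... | inj₂ 3∣2^n = 3∤2^ n 3∣2^n

-- The least b with h < k·2^b works: for positive b the preceding value is at most h, so this one is
-- at most 2h.
doubling : ∀ c {k h} → k ≤ 2 * h → h < k * 2 ^ c → ∃[ b ] b ≤ c × h < k * 2 ^ b × k * 2 ^ b ≤ 2 * h
doubling zero    {k} k≤ h< = 0 , z≤n , h< , subst (_≤ _) (sym (*-identityʳ k)) k≤
doubling (suc c) {k} {h} k≤ h< with h <? k * 2 ^ c
... | yes h<′ = let b , b≤c , rest = doubling c k≤ h<′ in b , m≤n⇒m≤1+n b≤c , rest
... | no h≮   = suc c , ≤-refl , h< , (begin
  k * (2 * 2 ^ c)   ≡⟨ solve 2 (λ k x → k :* (con 2 :* x) := con 2 :* (k :* x)) refl k (2 ^ c) ⟩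
  2 * (k * 2 ^ c)   ≤⟨ *-monoʳ-≤ 2 (≮⇒≥ h≮) ⟩
  2 * h             ∎)
  where
  open ≤-Reasoning
  open +-*-Solver

-- The largest i with j ≤ i ≤ j + fuel and 2 ^ i ∣ v, provided 2 ^ j ∣ v.
valuation : (fuel j v : ℕ) → ℕ
valuation zero    j v = j
valuation (suc f) j v = if does (2 ^ suc j ∣? v) then valuation f (suc j) v else j

valuation-∣ : ∀ f {j v} → 2 ^ j ∣ v → 2 ^ valuation f j v ∣ v
valuation-∣ zero            2^j∣v = 2^j∣v
valuation-∣ (suc f) {j} {v} 2^j∣v = if-elim (λ i → 2 ^ i ∣ v) (2 ^ suc j ∣? v) (valuation-∣ f) (λ _ → 2^j∣v)

valuation-max : ∀ f j {a v} → 2 ^ a ∣ v → a ≤ f + j → a ≤ valuation f j v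
valuation-max zero    j         2^a∣v a≤ = a≤
valuation-max (suc f) j {a} {v} 2^a∣v a≤ = if-elim (a ≤_) (2 ^ suc j ∣? v)
  (λ _ → valuation-max f (suc j) 2^a∣v (≤-trans a≤ (≤-reflexive (sym (+-suc f j)))))
  (λ 2^∤v → ≮⇒≥ λ j<a → 2^∤v (∣-trans (^-monoʳ-∣ 2 j<a) 2^a∣v))

valuation-periodic : ∀ f j {T} → 2 ^ (f + j) ∣ T → ∀ v → valuation f j (T + v) ≡ valuation f j v
valuation-periodic zero    j ∣T v = refl
valuation-periodic (suc f) j {T} ∣T v = cong₂ (λ b i → if b then i else j)
  (does-∣?-periodic (∣-trans (^-monoʳ-∣ 2 (s≤s (m≤n+m j f))) ∣T) v)
  (valuation-periodic f (suc j) (subst (λ e → 2 ^ e ∣ T) (sym (+-suc f j)) ∣T) v)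

chain tripled : ℕ → List ℕ
chain   = applyUpTo (2 ^_)
tripled = applyUpTo (λ i → 3 * 2 ^ i)

-- Upper bound: the cover by scaled chains.

module Cover (K : ℕ) where

  -- K doublings carry every element above n/2^K past n. J allows one more because an element 3k′
  -- with k′ prime to 3 is reached by doubling k′. The factor 9 of the period decides divisibility
  -- by 3 and 9, the factor 2^J the valuation capped at J.
  J period : ℕ
  J      = suc K
  period = 9 * 2 ^ J

  v₂ : ℕ → ℕ
  v₂ = valuation J 0

  2^v₂∣ : ∀ v → 2 ^ v₂ v ∣ v
  2^v₂∣ v = valuation-∣ J {0} (1∣ v)

  base : ℕ → ℕ
  base v = quotient (2^v₂∣ v)

  -- For v in (n/2 , n] take d = 1 if v ≤ 2n/3 and d = 2 otherwise, so that 3v / 2^d is the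
  -- largest 3v / 2^e ≤ n.  If 3 ∥ v there is no piece at v: the elements v / 2^e are found
  -- in the piece at 2v/3 or 4v/3.
  shape : ℕ → ℕ → List ℕ
  shape d v = if does (3 ∣? v)
    then (if does (9 ∣? v) then chain (suc (v₂ v)) else [])
    else chain (suc (v₂ v)) ++ tripled (suc (v₂ v) ∸ d)

  piece : ℕ → ℕ → List ℕ
  piece d v = map (base v *_) (shape d v)

  shape-periodic : ∀ {X : Set} d (f : List ℕ → X) v → f (shape d (period + v)) ≡ f (shape d v)
  shape-periodic d f v = cong f (trans
    (cong₂ (λ b c → if b then (if c then chain (suc (v₂ (period + v))) else [])
                    else chain (suc (v₂ (period + v))) ++ tripled (suc (v₂ (period + v)) ∸ d))
      (does-∣?-periodic {3} (∣m⇒∣m*n (2 ^ J) (divides 3 refl)) v)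
      (does-∣?-periodic {9} (m∣m*n (2 ^ J)) v))
    (cong (λ i → if does (3 ∣? v) then (if does (9 ∣? v) then chain (suc i) else [])
                 else chain (suc i) ++ tripled (suc i ∸ d))
      (valuation-periodic J 0 (∣n⇒∣m*n 9 (subst (λ e → 2 ^ e ∣ 2 ^ J) (sym (+-identityʳ J)) ∣-refl)) v)))

  module Weights (p q : ℕ) where

    weight volume : ℕ → ℕ → ℕ
    weight d v = WeightedSum.antichainSum p q [] (shape d v)
    volume d v = q ^ length (shape d v)

    -- The contribution of one unit of s, where n = 6B and B is s periods: 108 small elements, one
    -- period of (3B, 4B] with d = 1, and two periods of (4B, 6B] with d = 2, hence the square.
    coverWeight coverVolume : ℕ
    coverWeight = (p + q) ^ 108 * (prodUpTo (weight 1) period * prodUpTo (weight 2) period ^ 2)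
    coverVolume = q ^ 108 * (prodUpTo (volume 1) period * prodUpTo (volume 2) period ^ 2)

    coverVolume≢0 : .{{_ : NonZero q}} → NonZero coverVolume
    coverVolume≢0 = m*n≢0 (q ^ 108) _ {{m^n≢0 q 108}} {{m*n≢0 _ _ {{factor 1}} {{m^n≢0 _ 2 {{factor 2}}}}}}
      where
      factor : ∀ d → NonZero (prodUpTo (volume d) period)
      factor d = prodUpTo≢0 (λ v → m^n≢0 q (length (shape d v))) period

  base*2^ : ∀ {v k b} → v ≡ k * 2 ^ b → b ≤ v₂ v → base v * 2 ^ (v₂ v ∸ b) ≡ k
  base*2^ {v} {k} {b} v≡ b≤ = *-cancelʳ-≡ _ _ (2 ^ b) {{m^n≢0 2 b}} (begin
    base v * 2 ^ (v₂ v ∸ b) * 2 ^ b      ≡⟨ *-assoc (base v) (2 ^ (v₂ v ∸ b)) (2 ^ b) ⟩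
    base v * (2 ^ (v₂ v ∸ b) * 2 ^ b)    ≡⟨ cong (base v *_) (^-distribˡ-+-* 2 (v₂ v ∸ b) b) ⟨
    base v * 2 ^ (v₂ v ∸ b + b)          ≡⟨ cong (λ e → base v * 2 ^ e) (m∸n+n≡m b≤) ⟩
    base v * 2 ^ v₂ v                    ≡⟨ _∣_.equality (2^v₂∣ v) ⟨
    v                                    ≡⟨ v≡ ⟩
    k * 2 ^ b                            ∎)
    where open ≡-Reasoning

  ≤v₂ : ∀ {v k b} → v ≡ k * 2 ^ b → b ≤ J → b ≤ v₂ v
  ≤v₂ {k = k} v≡ b≤ = valuation-max J 0 (divides k v≡) (≤-trans b≤ (≤-reflexive (sym (+-identityʳ J))))

  ∈-chain : ∀ {v k b} → v ≡ k * 2 ^ b → b ≤ J → k ∈ map (base v *_) (chain (suc (v₂ v)))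
  ∈-chain {v} {k} {b} v≡ b≤ = subst (_∈ map (base v *_) (chain (suc (v₂ v)))) (base*2^ {v} {k} {b} v≡ (≤v₂ {v} {k} v≡ b≤))
    (∈-map⁺ (base v *_) (∈-applyUpTo⁺ (2 ^_) (s≤s (m∸n≤m (v₂ v) b))))

  ∈-tripled : ∀ {v k b d} → v ≡ k * 2 ^ b → b ≤ J → d ≤ b → k * 3 ∈ map (base v *_) (tripled (suc (v₂ v) ∸ d))
  ∈-tripled {v} {k} {b} {d} v≡ b≤ d≤b = subst (_∈ map (base v *_) (tripled (suc (v₂ v) ∸ d))) eq
    (∈-map⁺ (base v *_) (∈-applyUpTo⁺ (λ i → 3 * 2 ^ i) (begin
      suc (v₂ v ∸ b)   ≡⟨ +-∸-assoc 1 (≤v₂ {v} {k} v≡ b≤) ⟨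
      suc (v₂ v) ∸ b   ≤⟨ ∸-monoʳ-≤ (suc (v₂ v)) d≤b ⟩
      suc (v₂ v) ∸ d   ∎)))
    where
    open ≤-Reasoning
    open +-*-Solver
    eq : base v * (3 * 2 ^ (v₂ v ∸ b)) ≡ k * 3
    eq = trans (solve 2 (λ m x → m :* (con 3 :* x) := m :* x :* con 3) refl (base v) (2 ^ (v₂ v ∸ b)))
               (cong (_* 3) (base*2^ {v} {k} {b} v≡ (≤v₂ {v} {k} v≡ b≤)))

  shape-9∣ : ∀ d {v} → 9 ∣ v → shape d v ≡ chain (suc (v₂ v))
  shape-9∣ d {v} 9∣v rewrite dec-true (3 ∣? v) (∣-trans (divides 3 refl) 9∣v) | dec-true (9 ∣? v) 9∣v = refl

  shape-3∤ : ∀ d {v} → 3 ∤ v → shape d v ≡ chain (suc (v₂ v)) ++ tripled (suc (v₂ v) ∸ d)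
  shape-3∤ d {v} 3∤v rewrite dec-false (3 ∣? v) 3∤v = refl

  module _ (s : ℕ) where

    private
      B = s * period

    lowPieces highPieces tail cover : List ℕ
    lowPieces  = concat (map (piece 1) (range (3 * B) B))
    highPieces = concat (map (piece 2) (range (4 * B) (2 * B)))
    tail       = oneTo (108 * s)
    cover      = tail ++ lowPieces ++ highPieces

    locate : ∀ {v k} → 3 * B < v → v ≤ 6 * B → (v ≤ 4 * B → k ∈ piece 1 v) → (4 * B < v → k ∈ piece 2 v) → k ∈ cover
    locate {v} 3B<v v≤6B low high with v ≤? 4 * B
    ... | yes v≤4B = ∈-++⁺ʳ tail (∈-++⁺ˡ (∈-concat⁺′ (low v≤4B)
      (∈-map⁺ (piece 1) (∈-range⁺ 3B<v (≤-trans v≤4B (≤-reflexive (+-comm B (3 * B))))))))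
    ... | no v≰4B  = ∈-++⁺ʳ tail (∈-++⁺ʳ lowPieces (∈-concat⁺′ (high (≰⇒> v≰4B))
      (∈-map⁺ (piece 2) (∈-range⁺ (≰⇒> v≰4B) (≤-trans v≤6B (≤-reflexive (*-distribʳ-+ B 4 2)))))))

    2*3B : 2 * (3 * B) ≡ 6 * B
    2*3B = sym (*-assoc 2 3 B)

    -- The origin of 108: 6B / 2^K = 6·9·2^(K+1)·s / 2^K = 108s.
    beyond-tail : ∀ {k} → 108 * s < k → 6 * B < k * 2 ^ K
    beyond-tail {k} 108s<k = subst (_< k * 2 ^ K) eq (*-monoˡ-< (2 ^ K) {{m^n≢0 2 K}} 108s<k)
      where
      open +-*-Solver
      eq : 108 * s * 2 ^ K ≡ 6 * B
      eq = solve 2 (λ s x → con 108 :* s :* x := con 6 :* (s :* (con 9 :* (con 2 :* x)))) refl s (2 ^ K)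

    -- If 9 divides k or 3 does not, k is doubled into (3B, 6B], which keeps this property, and lies
    -- in the chain below the result. If k = 3k′ with k′ prime to 3, then k′ is doubled instead and
    -- k is found in the tripled part.
    oneTo⊆cover : oneTo (6 * B) ⊆ cover
    oneTo⊆cover {k} k∈ with k ≤? 108 * s
    ... | yes k≤tail = ∈-++⁺ˡ (∈-range⁺ {0} (proj₁ (∈-range⁻ {0} k∈)) k≤tail)
    ... | no k≰tail  = covered (3 ∣? k) (9 ∣? k)
      where
      k≤6B : k ≤ 6 * B
      k≤6B = proj₂ (∈-range⁻ {0} k∈)
      6B<k2^K : 6 * B < k * 2 ^ K
      6B<k2^K = beyond-tail (≰⇒> k≰tail)

      topOf : ∃[ b ] b ≤ K × 3 * B < k * 2 ^ b × k * 2 ^ b ≤ 2 * (3 * B)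
      topOf = doubling K (≤-trans k≤6B (≤-reflexive (sym 2*3B)))
        (≤-<-trans (*-monoˡ-≤ B (m≤m+n 3 3)) 6B<k2^K)

      covered : Dec (3 ∣ k) → Dec (9 ∣ k) → k ∈ cover
      covered _ (yes 9∣k) = let b , b≤K , 3B< , ≤6B = topOf in
        locate 3B< (≤-trans ≤6B (≤-reflexive 2*3B)) (λ _ → inPiece 1 b b≤K) (λ _ → inPiece 2 b b≤K)
        where
        inPiece : ∀ d b → b ≤ K → k ∈ piece d (k * 2 ^ b)
        inPiece d b b≤K = subst (λ xs → k ∈ map (base (k * 2 ^ b) *_) xs) (sym (shape-9∣ d (∣m⇒∣m*n (2 ^ b) 9∣k)))
          (∈-chain {k * 2 ^ b} {k} {b} refl (m≤n⇒m≤1+n b≤K))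
      covered (no 3∤k) _ = let b , b≤K , 3B< , ≤6B = topOf in
        locate 3B< (≤-trans ≤6B (≤-reflexive 2*3B)) (λ _ → inPiece 1 b b≤K) (λ _ → inPiece 2 b b≤K)
        where
        inPiece : ∀ d b → b ≤ K → k ∈ piece d (k * 2 ^ b)
        inPiece d b b≤K = subst (λ xs → k ∈ map (base (k * 2 ^ b) *_) xs) (sym (shape-3∤ d (3∤m*2^n 3∤k b)))
          (subst (k ∈_) (sym (map-++ (base (k * 2 ^ b) *_) (chain (suc (v₂ (k * 2 ^ b)))) _))
            (∈-++⁺ˡ (∈-chain {k * 2 ^ b} {k} {b} refl (m≤n⇒m≤1+n b≤K))))
      covered (yes (divides k′ refl)) (no 9∤k) = let b , b≤J , 3B< , ≤6B = top′ in
        locate 3B< (≤-trans ≤6B (≤-reflexive 2*3B))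
          (λ _ → inPiece 1 b b≤J (b≥1 b 3B<)) (λ 4B< → inPiece 2 b b≤J (b≥2 b 4B<))
        where
        open +-*-Solver
        k′≤2B : k′ ≤ 2 * B
        k′≤2B = *-cancelʳ-≤ _ _ 3 (≤-trans k≤6B (≤-reflexive
          (solve 1 (λ B → con 6 :* B := con 2 :* B :* con 3) refl B)))
        -- With one extra doubling k′·2^J is two thirds of k·2^K, hence above 4B; without it only 2B
        -- would be guaranteed.
        3B<k′2^J : 3 * B < k′ * 2 ^ J
        3B<k′2^J = *-cancelʳ-< 3 _ _ (begin-strict
          3 * B * 3           ≤⟨ m≤m+n _ (3 * B) ⟩
          3 * B * 3 + 3 * B   ≡⟨ solve 1 (λ B → con 3 :* B :* con 3 :+ con 3 :* B := con 2 :* (con 6 :* B)) refl B ⟩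
          2 * (6 * B)         <⟨ *-monoʳ-< 2 6B<k2^K ⟩
          2 * (k′ * 3 * 2 ^ K) ≡⟨ solve 2 (λ k x → con 2 :* (k :* con 3 :* x) := k :* (con 2 :* x) :* con 3) refl k′ (2 ^ K) ⟩
          k′ * 2 ^ J * 3      ∎)
          where open ≤-Reasoning
        top′ : ∃[ b ] b ≤ J × 3 * B < k′ * 2 ^ b × k′ * 2 ^ b ≤ 2 * (3 * B)
        top′ = doubling J (≤-trans k′≤2B (≤-trans (*-monoˡ-≤ B (m≤m+n 2 4)) (≤-reflexive (sym 2*3B)))) 3B<k′2^J
        3∤k′ : 3 ∤ k′
        3∤k′ (divides m refl) = 9∤k (divides m (*-assoc m 3 3))
        b≥1 : ∀ b → 3 * B < k′ * 2 ^ b → 1 ≤ b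
        b≥1 zero    3B< = contradiction (≤-trans k′≤2B (*-monoˡ-≤ B (m≤m+n 2 1)))
          (<⇒≱ (subst (3 * B <_) (*-identityʳ k′) 3B<))
        b≥1 (suc b) _ = s≤s z≤n
        -- k ≤ 6B gives k′ ≤ 2B, so one doubling stays within 4B. Thus the number of doublings is at
        -- least the shift d by which the tripled part is shortened.
        b≥2 : ∀ b → 4 * B < k′ * 2 ^ b → 2 ≤ b
        b≥2 zero    4B< = contradiction (≤-trans k′≤2B (*-monoˡ-≤ B (m≤m+n 2 2)))
          (<⇒≱ (subst (4 * B <_) (*-identityʳ k′) 4B<))
        b≥2 (suc zero) 4B< = contradiction (≤-trans (*-monoˡ-≤ 2 k′≤2B)
            (≤-reflexive (solve 1 (λ B → con 2 :* B :* con 2 := con 4 :* B) refl B)))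
          (<⇒≱ 4B<)
        b≥2 (suc (suc b)) _ = s≤s (s≤s z≤n)
        inPiece : ∀ d b → b ≤ J → d ≤ b → k′ * 3 ∈ piece d (k′ * 2 ^ b)
        inPiece d b b≤J d≤b = subst (λ xs → k′ * 3 ∈ map (base (k′ * 2 ^ b) *_) xs) (sym (shape-3∤ d (3∤m*2^n 3∤k′ b)))
          (subst (k′ * 3 ∈_) (sym (map-++ (base (k′ * 2 ^ b) *_) (chain (suc (v₂ (k′ * 2 ^ b)))) _))
            (∈-++⁺ʳ (map (base (k′ * 2 ^ b) *_) (chain (suc (v₂ (k′ * 2 ^ b)))))
              (∈-tripled {k′ * 2 ^ b} {k′} {b} {d} refl b≤J d≤b)))

    module _ (p q : ℕ) where

      open WeightedSum p q

      open Weights p q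

      primSum-piece : ∀ d {v} → 0 < v → primSum (piece d v) ≡ weight d v
      primSum-piece d {v} 0<v = trans
        (primSum-map-* (base v) {{quotient≢0 (2^v₂∣ v) {{>-nonZero 0<v}}}} (shape d v))
        (primSum≡antichainSum (shape d v))

      -- Used with x = p + q for weights and x = q for volumes. Both intervals start at multiples of
      -- the period, so each product splits into equal full periods.
      blockwise : ∀ x {f g : ℕ → ℕ} → Periodic period f → Periodic period g →
        x ^ (108 * s) * (prodRange f (3 * B) B * prodRange g (4 * B) (2 * B)) ≡
        (x ^ 108 * (prodUpTo f period * prodUpTo g period ^ 2)) ^ s
      blockwise x {f} {g} perf perg = begin
        x ^ (108 * s) * (prodRange f (3 * B) B * prodRange g (4 * B) (2 * B))
          ≡⟨ cong₂ (λ a b → a * (prodRange f (3 * B) B * prodRange g (4 * B) b))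
               (^-*-assoc x 108 s) (*-assoc 2 s period) ⟨
        (x ^ 108) ^ s * (prodRange f (3 * B) (s * period) * prodRange g (4 * B) (2 * s * period))
          ≡⟨ cong₂ (λ a b → (x ^ 108) ^ s * (a * b))
               (prodRange-periodic perf (∣n⇒∣m*n 3 (n∣m*n s)) s)
               (prodRange-periodic perg (∣n⇒∣m*n 4 (n∣m*n s)) (2 * s)) ⟩
        (x ^ 108) ^ s * (prodUpTo f period ^ s * prodUpTo g period ^ (2 * s))
          ≡⟨ cong (λ a → (x ^ 108) ^ s * (prodUpTo f period ^ s * a)) (^-*-assoc (prodUpTo g period) 2 s) ⟨
        (x ^ 108) ^ s * (prodUpTo f period ^ s * (prodUpTo g period ^ 2) ^ s)
          ≡⟨ cong ((x ^ 108) ^ s *_) (^-distribʳ-* s (prodUpTo f period) _) ⟨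
        (x ^ 108) ^ s * (prodUpTo f period * prodUpTo g period ^ 2) ^ s
          ≡⟨ ^-distribʳ-* s (x ^ 108) _ ⟨
        (x ^ 108 * (prodUpTo f period * prodUpTo g period ^ 2)) ^ s ∎
        where open ≡-Reasoning

      primSum-pieces : ∀ d a n → primSum (concat (map (piece d) (range a n))) ≤ prodRange (weight d) a n
      primSum-pieces d a n = ≤-trans (primSum-concat-≤ (piece d) (range a n))
        (≤-reflexive (cong product (map-cong-local
          (All.tabulate λ v∈ → primSum-piece d (m<n⇒0<n (proj₁ (∈-range⁻ {a} {n} v∈)))))))

      primSum-cover : primSum cover ≤ coverWeight ^ s
      primSum-cover = begin
        primSum cover                                            ≤⟨ primSum-++-≤ tail (lowPieces ++ highPieces) ⟩
        primSum tail * primSum (lowPieces ++ highPieces)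
          ≤⟨ *-mono-≤ (≤-trans (primSum-≤-^ tail) (≤-reflexive (cong ((p + q) ^_) (length-range 0 (108 * s)))))
                      (primSum-++-≤ lowPieces highPieces) ⟩
        (p + q) ^ (108 * s) * (primSum lowPieces * primSum highPieces)
          ≤⟨ *-monoʳ-≤ ((p + q) ^ (108 * s))
               (*-mono-≤ (primSum-pieces 1 (3 * B) B) (primSum-pieces 2 (4 * B) (2 * B))) ⟩
        (p + q) ^ (108 * s) * (prodRange (weight 1) (3 * B) B * prodRange (weight 2) (4 * B) (2 * B))
          ≡⟨ blockwise (p + q) (shape-periodic 1 (antichainSum [])) (shape-periodic 2 (antichainSum [])) ⟩
        coverWeight ^ s                                          ∎
        where open ≤-Reasoning

      volume-pieces : ∀ d vs → q ^ length (concat (map (piece d) vs)) ≡ product (map (volume d) vs)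
      volume-pieces d []       = refl
      volume-pieces d (v ∷ vs) = begin
        q ^ length (piece d v ++ concat (map (piece d) vs))
          ≡⟨ cong (q ^_) (length-++ (piece d v)) ⟩
        q ^ (length (piece d v) + length (concat (map (piece d) vs)))
          ≡⟨ ^-distribˡ-+-* q (length (piece d v)) _ ⟩
        q ^ length (piece d v) * q ^ length (concat (map (piece d) vs))
          ≡⟨ cong₂ (λ l x → q ^ l * x) (length-map (base v *_) (shape d v)) (volume-pieces d vs) ⟩
        volume d v * product (map (volume d) vs) ∎
        where open ≡-Reasoning

      volume-cover : q ^ length cover ≡ coverVolume ^ s
      volume-cover = begin
        q ^ length cover
          ≡⟨ cong (q ^_) (trans (length-++ tail) (cong₂ _+_ (length-range 0 (108 * s)) (length-++ lowPieces))) ⟩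
        q ^ (108 * s + (length lowPieces + length highPieces))
          ≡⟨ trans (^-distribˡ-+-* q (108 * s) _) (cong (q ^ (108 * s) *_) (^-distribˡ-+-* q (length lowPieces) _)) ⟩
        q ^ (108 * s) * (q ^ length lowPieces * q ^ length highPieces)
          ≡⟨ cong₂ (λ a b → q ^ (108 * s) * (a * b))
               (volume-pieces 1 (range (3 * B) B)) (volume-pieces 2 (range (4 * B) (2 * B))) ⟩
        q ^ (108 * s) * (prodRange (volume 1) (3 * B) B * prodRange (volume 2) (4 * B) (2 * B))
          ≡⟨ blockwise q (shape-periodic 1 ((q ^_) ∘ length)) (shape-periodic 2 ((q ^_) ∘ length)) ⟩
        coverVolume ^ s ∎
        where open ≡-Reasoning

      -- The r elements above 6B cost at most p + q each. The division by the volume of the cover is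
      -- cleared to stay within natural numbers.
      primSum-oneTo-≤ : ∀ r → primSum (oneTo (6 * B + r)) * coverVolume ^ s ≤
                              (p + q) ^ r * q ^ (6 * B) * coverWeight ^ s
      primSum-oneTo-≤ r = begin
        primSum (oneTo (6 * B + r)) * coverVolume ^ s
          ≡⟨ cong (λ xs → primSum xs * coverVolume ^ s) (range-++ {0} (6 * B) r refl) ⟨
        primSum (oneTo (6 * B) ++ range (6 * B) r) * coverVolume ^ s
          ≤⟨ *-monoˡ-≤ (coverVolume ^ s) (≤-trans (primSum-++-≤ (oneTo (6 * B)) (range (6 * B) r))
               (*-monoʳ-≤ (primSum (oneTo (6 * B))) (≤-trans (primSum-≤-^ (range (6 * B) r))
                 (≤-reflexive (cong ((p + q) ^_) (length-range (6 * B) r)))))) ⟩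
        primSum (oneTo (6 * B)) * (p + q) ^ r * coverVolume ^ s
          ≡⟨ solve 3 (λ a b c → a :* b :* c := b :* (a :* c)) refl (primSum (oneTo (6 * B))) ((p + q) ^ r) (coverVolume ^ s) ⟩
        (p + q) ^ r * (primSum (oneTo (6 * B)) * coverVolume ^ s)
          ≡⟨ cong (λ x → (p + q) ^ r * (primSum (oneTo (6 * B)) * x)) volume-cover ⟨
        (p + q) ^ r * (primSum (oneTo (6 * B)) * q ^ length cover)
          ≤⟨ *-monoʳ-≤ ((p + q) ^ r) (primSum-⊆ (range-unique 0 (6 * B)) oneTo⊆cover) ⟩
        (p + q) ^ r * (primSum cover * q ^ length (oneTo (6 * B)))
          ≤⟨ *-monoʳ-≤ ((p + q) ^ r) (*-mono-≤ primSum-cover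
               (≤-reflexive (cong (q ^_) (length-range 0 (6 * B))))) ⟩
        (p + q) ^ r * (coverWeight ^ s * q ^ (6 * B))
          ≡⟨ solve 3 (λ a b c → a :* (b :* c) := a :* c :* b) refl ((p + q) ^ r) (coverWeight ^ s) (q ^ (6 * B)) ⟩
        (p + q) ^ r * q ^ (6 * B) * coverWeight ^ s ∎
        where
        open ≤-Reasoning
        open +-*-Solver

-- Comparison of the two bounds for large n.

-- In fractions: c ≤ R (B/A)^s ≤ R (G/2)^s ≤ (R/2^s) N, and 2^s is at least 4R.
rare : ∀ {A B G R c N} s .{{_ : NonZero A}} →
       2 * B ≤ G * A → 4 * R ≤ 2 ^ s → G ^ s ≤ N → c * A ^ s ≤ R * B ^ s → 4 * c ≤ N
rare {A} {B} {G} {R} {c} {N} s 2B≤GA 4R≤2^s G^s≤N c≤ = *-cancelʳ-≤ _ _ (A ^ s) {{m^n≢0 A s}} (begin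
  4 * c * A ^ s          ≡⟨ *-assoc 4 c (A ^ s) ⟩
  4 * (c * A ^ s)        ≤⟨ *-monoʳ-≤ 4 c≤ ⟩
  4 * (R * B ^ s)        ≡⟨ *-assoc 4 R (B ^ s) ⟨
  4 * R * B ^ s          ≤⟨ *-monoˡ-≤ (B ^ s) 4R≤2^s ⟩
  2 ^ s * B ^ s          ≡⟨ ^-distribʳ-* s 2 B ⟨
  (2 * B) ^ s            ≤⟨ ^-monoˡ-≤ s 2B≤GA ⟩
  (G * A) ^ s            ≡⟨ ^-distribʳ-* s G A ⟩
  G ^ s * A ^ s          ≤⟨ *-monoˡ-≤ (A ^ s) G^s≤N ⟩
  N * A ^ s              ∎)
  where open ≤-Reasoning

-- s₀ counts the stretches of 24 integers used by the lower bound within one period of n, so that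
-- both bounds become s-th powers.
module Asymptotics (K s₀ : ℕ) (6period≡24s₀ : 6 * Cover.period K ≡ 24 * s₀) where

  open Cover K using (period; module Weights; volume-cover; cover; primSum-oneTo-≤)

  M G : ℕ
  M = 6 * period
  G = 34560 ^ s₀

  6[s*period]≡s*M : ∀ s → 6 * (s * period) ≡ s * M
  6[s*period]≡s*M s = solve 2 (λ s t → con 6 :* (s :* t) := s :* (con 6 :* t)) refl s period
    where open +-*-Solver

  module _ (s r : ℕ) (r<M : r < M) where

    private
      n = 6 * (s * period) + r

    sM≤n : s * M ≤ n
    sM≤n = ≤-trans (≤-reflexive (sym (6[s*period]≡s*M s))) (m≤m+n _ r)

    n≤[1+s]M : n ≤ suc s * M
    n≤[1+s]M = begin
      6 * (s * period) + r  ≡⟨ cong (_+ r) (6[s*period]≡s*M s) ⟩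
      s * M + r             ≤⟨ +-monoʳ-≤ (s * M) (<⇒≤ r<M) ⟩
      s * M + M             ≡⟨ +-comm (s * M) M ⟩
      suc s * M             ∎
      where open ≤-Reasoning

    many : G ^ s ≤ primitiveCount n
    many = begin
      G ^ s                                          ≡⟨ ^-*-assoc 34560 s₀ s ⟩
      34560 ^ (s₀ * s)                               ≤⟨ TopThreeQuarters.34560^q≤primSum (s₀ * s) ⟩
      WeightedSum.primSum 1 1 (oneTo (24 * (s₀ * s)))
        ≤⟨ primSum-mono-⊆ (range-unique 0 (24 * (s₀ * s))) (λ x∈ →
             let 0<x , x≤ = ∈-range⁻ {0} x∈ in ∈-range⁺ {0} 0<x (≤-trans x≤ 24s₀s≤n)) ⟩
      WeightedSum.primSum 1 1 (oneTo n)              ≡⟨ primitiveCount≡primSum n ⟨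
      primitiveCount n                               ∎
      where
      open ≤-Reasoning
      24s₀s≤n : 24 * (s₀ * s) ≤ n
      24s₀s≤n = begin
        24 * (s₀ * s)     ≡⟨ *-assoc 24 s₀ s ⟨
        24 * s₀ * s       ≡⟨ cong (_* s) 6period≡24s₀ ⟨
        M * s             ≡⟨ *-comm M s ⟩
        s * M             ≤⟨ sM≤n ⟩
        n                 ∎

    -- Rounding n down to s periods, a large set has at least κs elements and thus weight at least
    -- 3^(κs). As q = 1, all volumes are 1.
    few-large : ∀ d D κ .{{_ : NonZero D}} → D * κ ≤ d * M →
      2 * Weights.coverWeight 3 1 ≤ G * 3 ^ κ → 4 * 4 ^ M ≤ 2 ^ s →
      4 * countP (atLeast? d D n) (sizes n) ≤ primitiveCount n
    few-large d D κ Dκ≤dM gap long = rare {3 ^ κ} {coverWeight} {G} {4 ^ M} {c} s {{m^n≢0 3 κ}} gap long many (begin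
      c * (3 ^ κ) ^ s                                ≡⟨ cong (c *_) (^-*-assoc 3 κ s) ⟩
      c * 3 ^ (κ * s)                                ≡⟨ *-comm c _ ⟩
      3 ^ (κ * s) * c                                ≤⟨ markov (atLeast? d D n) 3 1 (3 ^ (κ * s)) n heavy ⟩
      primSum (oneTo n)                              ≡⟨ *-identityʳ _ ⟨
      primSum (oneTo n) * 1                          ≡⟨ cong (primSum (oneTo n) *_) volume≡1 ⟨
      primSum (oneTo n) * Weights.coverVolume 3 1 ^ s ≤⟨ primSum-oneTo-≤ s 3 1 r ⟩
      4 ^ r * 1 ^ (6 * (s * period)) * coverWeight ^ s
        ≡⟨ cong (λ x → 4 ^ r * x * coverWeight ^ s) (^-zeroˡ (6 * (s * period))) ⟩
      4 ^ r * 1 * coverWeight ^ s                    ≡⟨ cong (_* coverWeight ^ s) (*-identityʳ (4 ^ r)) ⟩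
      4 ^ r * coverWeight ^ s                        ≤⟨ *-monoˡ-≤ (coverWeight ^ s) (^-monoʳ-≤ 4 (<⇒≤ r<M)) ⟩
      4 ^ M * coverWeight ^ s                        ∎)
      where
      open ≤-Reasoning
      open WeightedSum 3 1
      open Weights 3 1 using (coverWeight)
      c = countP (atLeast? d D n) (sizes n)
      volume≡1 : Weights.coverVolume 3 1 ^ s ≡ 1
      volume≡1 = trans (sym (volume-cover s 3 1)) (^-zeroˡ (length (cover s)))
      heavy : ∀ t → t ≤ n → AtLeast d D n t → 3 ^ (κ * s) ≤ 3 ^ t * 1 ^ (n ∸ t)
      heavy t _ dn≤Dt = begin
        3 ^ (κ * s)           ≤⟨ ^-monoʳ-≤ 3 (*-cancelˡ-≤ D κs≤t) ⟩
        3 ^ t                 ≡⟨ *-identityʳ _ ⟨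
        3 ^ t * 1             ≡⟨ cong (3 ^ t *_) (^-zeroˡ (n ∸ t)) ⟨
        3 ^ t * 1 ^ (n ∸ t)   ∎
        where
        κs≤t : D * (κ * s) ≤ D * t
        κs≤t = begin
          D * (κ * s)   ≡⟨ *-assoc D κ s ⟨
          D * κ * s     ≤⟨ *-monoˡ-≤ s Dκ≤dM ⟩
          d * M * s     ≡⟨ trans (*-assoc d M s) (cong (d *_) (*-comm M s)) ⟩
          d * (s * M)   ≤⟨ *-monoʳ-≤ d sM≤n ⟩
          d * n         ≤⟨ dn≤Dt ⟩
          D * t         ∎

    -- Here n is rounded up to s + 1 periods, so a small set has at most ℓ(s + 1) elements. The
    -- additional period costs only the constant factor 3^ℓ.
    few-small : ∀ d D ℓ .{{_ : NonZero D}} → d * M ≤ D * ℓ →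
      2 * (3 ^ ℓ * Weights.coverWeight 1 3) ≤ G * Weights.coverVolume 1 3 → 4 * (4 ^ M * 3 ^ ℓ) ≤ 2 ^ s →
      4 * countP (atMost? d D n) (sizes n) ≤ primitiveCount n
    few-small d D ℓ dM≤Dℓ gap long = rare {coverVolume} {3 ^ ℓ * coverWeight} {G} {4 ^ M * 3 ^ ℓ} {c} s {{coverVolume≢0}} gap long many
      -- Multiplying by 3^(6B) avoids negative exponents: 6B ≤ n ≤ e + (n ∸ e) holds even if the
      -- subtraction is truncated.
      (*-cancelˡ-≤ (3 ^ (6 * (s * period))) {{m^n≢0 3 (6 * (s * period))}} (begin
        3 ^ (6 * (s * period)) * (c * coverVolume ^ s)
          ≤⟨ *-monoˡ-≤ (c * coverVolume ^ s) (begin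
               3 ^ (6 * (s * period))          ≤⟨ ^-monoʳ-≤ 3 (≤-trans (m≤m+n _ r) (m≤n+m∸n n e)) ⟩
               3 ^ (e + (n ∸ e))               ≡⟨ ^-distribˡ-+-* 3 e (n ∸ e) ⟩
               3 ^ e * 3 ^ (n ∸ e)             ∎) ⟩
        3 ^ e * 3 ^ (n ∸ e) * (c * coverVolume ^ s)
          ≡⟨ solve 4 (λ a b c v → a :* b :* (c :* v) := a :* (b :* c :* v)) refl
               (3 ^ e) (3 ^ (n ∸ e)) c (coverVolume ^ s) ⟩
        3 ^ e * (3 ^ (n ∸ e) * c * coverVolume ^ s)
          ≤⟨ *-monoʳ-≤ (3 ^ e) (*-monoˡ-≤ (coverVolume ^ s) (markov (atMost? d D n) 1 3 (3 ^ (n ∸ e)) n heavy)) ⟩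
        3 ^ e * (primSum (oneTo n) * coverVolume ^ s)
          ≤⟨ *-monoʳ-≤ (3 ^ e) (primSum-oneTo-≤ s 1 3 r) ⟩
        3 ^ e * (4 ^ r * 3 ^ (6 * (s * period)) * coverWeight ^ s)
          ≤⟨ *-monoʳ-≤ (3 ^ e) (*-monoˡ-≤ (coverWeight ^ s)
               (*-monoˡ-≤ (3 ^ (6 * (s * period))) (^-monoʳ-≤ 4 (<⇒≤ r<M)))) ⟩
        3 ^ e * (4 ^ M * 3 ^ (6 * (s * period)) * coverWeight ^ s)
          ≡⟨ cong (_* (4 ^ M * 3 ^ (6 * (s * period)) * coverWeight ^ s)) 3^e ⟩
        3 ^ ℓ * (3 ^ ℓ) ^ s * (4 ^ M * 3 ^ (6 * (s * period)) * coverWeight ^ s)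
          ≡⟨ solve 5 (λ a b x y w → a :* b :* (x :* y :* w) := y :* (x :* a :* (b :* w))) refl
               (3 ^ ℓ) ((3 ^ ℓ) ^ s) (4 ^ M) (3 ^ (6 * (s * period))) (coverWeight ^ s) ⟩
        3 ^ (6 * (s * period)) * (4 ^ M * 3 ^ ℓ * ((3 ^ ℓ) ^ s * coverWeight ^ s))
          ≡⟨ cong (λ x → 3 ^ (6 * (s * period)) * (4 ^ M * 3 ^ ℓ * x)) (^-distribʳ-* s (3 ^ ℓ) coverWeight) ⟨
        3 ^ (6 * (s * period)) * (4 ^ M * 3 ^ ℓ * (3 ^ ℓ * coverWeight) ^ s) ∎))
      where
      open ≤-Reasoning
      open +-*-Solver
      open WeightedSum 1 3
      open Weights 1 3 using (coverWeight; coverVolume; coverVolume≢0)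
      c = countP (atMost? d D n) (sizes n)
      e = ℓ * suc s
      3^e : 3 ^ e ≡ 3 ^ ℓ * (3 ^ ℓ) ^ s
      3^e = trans (cong (3 ^_) (*-suc ℓ s)) (trans (^-distribˡ-+-* 3 ℓ (ℓ * s))
        (cong (3 ^ ℓ *_) (sym (^-*-assoc 3 ℓ s))))
      heavy : ∀ t → t ≤ n → AtMost d D n t → 3 ^ (n ∸ e) ≤ 1 ^ t * 3 ^ (n ∸ t)
      heavy t _ Dt≤dn = begin
        3 ^ (n ∸ e)           ≤⟨ ^-monoʳ-≤ 3 (∸-monoʳ-≤ n (*-cancelˡ-≤ D t≤e)) ⟩
        3 ^ (n ∸ t)           ≡⟨ *-identityˡ _ ⟨
        1 * 3 ^ (n ∸ t)       ≡⟨ cong (_* 3 ^ (n ∸ t)) (^-zeroˡ t) ⟨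
        1 ^ t * 3 ^ (n ∸ t)   ∎
        where
        t≤e : D * t ≤ D * e
        t≤e = begin
          D * t             ≤⟨ Dt≤dn ⟩
          d * n             ≤⟨ *-monoʳ-≤ d n≤[1+s]M ⟩
          d * (suc s * M)   ≡⟨ trans (cong (d *_) (*-comm (suc s) M)) (sym (*-assoc d M (suc s))) ⟩
          d * M * suc s     ≤⟨ *-monoˡ-≤ (suc s) dM≤Dℓ ⟩
          D * ℓ * suc s     ≡⟨ *-assoc D ℓ (suc s) ⟩
          D * e             ∎

  4*4^M*3^ℓ≤2^s : ∀ ℓ s → 2 + 2 * M + 2 * ℓ ≤ s → 4 * (4 ^ M * 3 ^ ℓ) ≤ 2 ^ s
  4*4^M*3^ℓ≤2^s ℓ s ≤s = begin
    4 * (4 ^ M * 3 ^ ℓ)                    ≤⟨ *-monoʳ-≤ 4 (*-monoʳ-≤ (4 ^ M) (^-monoˡ-≤ ℓ (n≤1+n 3))) ⟩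
    4 * (4 ^ M * 4 ^ ℓ)
      ≡⟨ cong₂ (λ a b → 4 * (a * b)) (^-*-assoc 2 2 M) (^-*-assoc 2 2 ℓ) ⟩
    2 ^ 2 * (2 ^ (2 * M) * 2 ^ (2 * ℓ))    ≡⟨ *-assoc (2 ^ 2) (2 ^ (2 * M)) (2 ^ (2 * ℓ)) ⟨
    2 ^ 2 * 2 ^ (2 * M) * 2 ^ (2 * ℓ)      ≡⟨ cong (_* 2 ^ (2 * ℓ)) (^-distribˡ-+-* 2 2 (2 * M)) ⟨
    2 ^ (2 + 2 * M) * 2 ^ (2 * ℓ)          ≡⟨ ^-distribˡ-+-* 2 (2 + 2 * M) (2 * ℓ) ⟨
    2 ^ (2 + 2 * M + 2 * ℓ)                ≤⟨ ^-monoʳ-≤ 2 ≤s ⟩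
    2 ^ s                                  ∎
    where open ≤-Reasoning

  -- d₁ / D and d₂ / D bound the median density, ℓ / M and κ / M approximate them.
  medianBounds : ∀ d₁ d₂ D ℓ κ .{{_ : NonZero D}} .{{_ : NonZero M}} →
    d₁ * M ≤ D * ℓ → D * κ ≤ d₂ * M →
    2 * (3 ^ ℓ * Weights.coverWeight 1 3) ≤ G * Weights.coverVolume 1 3 →
    2 * Weights.coverWeight 3 1 ≤ G * 3 ^ κ →
    ∀ n → n ≥ (2 + 2 * M + 2 * ℓ) * M →
    ((d₁ + d₁) * n < D * twiceν n) × (D * twiceν n < (d₂ + d₂) * n)
  medianBounds d₁ d₂ D ℓ κ low high gapLow gapHigh n n≥ =
    subst (λ n → ((d₁ + d₁) * n < D * twiceν n) × (D * twiceν n < (d₂ + d₂) * n)) n≡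
      ( twiceν-> d₁ D n′ nonempty (few-small s r r<M d₁ D ℓ low gapLow (4*4^M*3^ℓ≤2^s ℓ s s≥))
      , twiceν-< d₂ D n′ nonempty (few-large s r r<M d₂ D κ high gapHigh
          (≤-trans (*-monoʳ-≤ 4 (m≤m*n (4 ^ M) (3 ^ ℓ) {{m^n≢0 3 ℓ}})) (4*4^M*3^ℓ≤2^s ℓ s s≥))))
    where
    s r n′ : ℕ
    s  = n / M
    r  = n % M
    n′ = 6 * (s * period) + r
    n≡ : n′ ≡ n
    n≡ = trans (cong (_+ r) (6[s*period]≡s*M s)) (trans (+-comm (s * M) r) (sym (m≡m%n+[m/n]*n n M)))
    r<M : r < M
    r<M = m%n<n n M
    s≥ : 2 + 2 * M + 2 * ℓ ≤ s
    s≥ = ≤-trans (≤-reflexive (sym (m*n/n≡m (2 + 2 * M + 2 * ℓ) M))) (/-monoˡ-≤ M n≥)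
    nonempty : 0 < primitiveCount n′
    nonempty = ≤-trans (m^n>0 G {{m^n≢0 34560 s₀}} s) (many s r r<M)

-- Exact evaluation of the two numerical inequalities.

≤ᵇ-true⇒≤ : ∀ {m n} → (m ≤ᵇ n) ≡ true → m ≤ n
≤ᵇ-true⇒≤ {m} {n} eq = ≤ᵇ⇒≤ m n (subst Bool.T (sym eq) tt)

abstract
  -- Boolean comparisons of explicit integers, decided by evaluation; `abstract` prevents these
  -- proofs from being unfolded afterwards.
  gapLow : (2 * (3 ^ 9299 * Cover.Weights.coverWeight 9 1 3) ≤ᵇ 34560 ^ 2304 * Cover.Weights.coverVolume 9 1 3) ≡ true
  gapLow = refl

  gapHigh : (2 * Cover.Weights.coverWeight 9 3 1 ≤ᵇ 34560 ^ 2304 * 3 ^ 21662) ≡ true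
  gapHigh = refl

theorem2p6 : Σ ℕ λ N → (n : ℕ) → n ≥ N →
    (336306 * n < 1000000 * twiceν n) × (1000000 * twiceν n < 783504 * n)
theorem2p6 = _ , medianBounds 168153 391752 1000000 9299 21662
  (≤ᵇ-true⇒≤ refl) (≤ᵇ-true⇒≤ refl) (≤ᵇ-true⇒≤ gapLow) (≤ᵇ-true⇒≤ gapHigh)
  -- 55296 = 6·9·2¹⁰ = 24·2304 is the period; 9299/55296 and 21662/55296 are the nearest
  -- fractions above 0.168153 and below 0.391752.
  where open Asymptotics 9 2304 refl
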